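{- Let $\Gamma$ be a signed graph in which every connected component has at least two vertices. Then $$\eta(\Gamma) \leq \begin{cases} 2c(\Gamma)+p(\Gamma)-1, & \text{if } p(\Gamma)\geq 1;\\ 2c(\Gamma), & \text{if } p(\Gamma)=0 \text{ and } \Gamma \text{ is a cycle-disjoint signed graph};\\ 2c(\Gamma)-1, & \text{if } p(\Gamma)=0 \text{ and some two distinct cycles of } \Gamma \text{ have a common vertex}.\end{cases}$$
   Context: All graphs are simple and finite. A signed graph $\Gamma=(G,\sigma)$ consists of a simple graph $G$ (the underlying graph) and a map $\sigma:E(G)\to\{+,-\}$. Its adjacency matrix $A(\Gamma)=(a^\sigma_{ij})$ has $a^\sigma_{ij}=\sigma(v_iv_j)$ if $v_i\sim v_j$ and $0$ otherwise. The nullity $\eta(\Gamma)$ is the multiplicity of $0$ as an eigenvalue of $A(\Gamma)$. The cyclomatic number is $c(\Gamma)=|E(G)|-|V(G)|+\omega(G)$, where $\omega(G)$ is the number of connected components of $G$, and $p(\Gamma)$ is the number of pendant vertices (vertices of degree one) of $G$. $\Gamma$ is called cycle-disjoint if any two distinct cycles of $\Gamma$ (if any) have no common vertices. -}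

module Defs where

open import Data.Nat using (ℕ; zero; suc; _≤_; _<ᵇ_)
open import Data.Bool using (Bool; true; false; if_then_else_; _∧_; _∨_; not)
open import Data.Fin using (Fin; zero; suc; toℕ; punchIn; _≟_)
open import Data.Integer as ℤ using (ℤ; +_; -_)
open import Data.List using (List; []; _∷_; _++_; [_]; length)
open import Data.List.Relation.Unary.All using (All)
open import Data.List.Relation.Unary.Unique.Propositional using (Unique)
open import Data.List.Membership.Propositional using (_∈_)
open import Data.Product using (_×_; _,_; Σ; ∃)
open import Data.Sum using (_⊎_)
open import Relation.Nullary using (¬_)
open import Relation.Nullary.Decidable using (⌊_⌋)
open import Relation.Binary.PropositionalEquality using (_≡_)

countF : ∀ {n} → (Fin n → Bool) → ℕ
countF {zero}  P = 0
countF {suc n} P = (if P zero then 1 else 0) Data.Nat.+ countF (λ i → P (suc i))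

anyF : ∀ {n} → (Fin n → Bool) → Bool
anyF {zero}  P = false
anyF {suc n} P = P zero ∨ anyF (λ i → P (suc i))

-- Signed graphs on vertex set Fin n (simple: symmetric, loopless).
-- sign i j = true means the edge ij is positive, false means negative.

record SignedGraph (n : ℕ) : Set where
  field
    adj        : Fin n → Fin n → Bool
    adj-sym    : ∀ i j → adj i j ≡ adj j i
    adj-irrefl : ∀ i → adj i i ≡ false
    sign       : Fin n → Fin n → Bool
    sign-sym   : ∀ i j → sign i j ≡ sign j i

open SignedGraph public

adjMatrix : ∀ {n} → SignedGraph n → Fin n → Fin n → ℤ
adjMatrix Γ i j =
  if adj Γ i j then (if sign Γ i j then + 1 else - (+ 1)) else + 0

-- Polynomials over ℤ (coefficient lists, ascending degree)

Poly : Set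
Poly = List ℤ

_+P_ : Poly → Poly → Poly
[] +P q = q
(a ∷ p) +P [] = a ∷ p
(a ∷ p) +P (b ∷ q) = (a ℤ.+ b) ∷ (p +P q)

scaleP : ℤ → Poly → Poly
scaleP c [] = []
scaleP c (a ∷ p) = (c ℤ.* a) ∷ scaleP c p

_*P_ : Poly → Poly → Poly
[] *P q = []
(a ∷ p) *P q = scaleP a q +P (+ 0 ∷ (p *P q))

sumP : ∀ {n} → (Fin n → Poly) → Poly
sumP {zero}  f = []
sumP {suc n} f = f zero +P sumP (λ i → f (suc i))

altSign : ∀ {n} → Fin n → ℤ
altSign zero = + 1
altSign (suc j) = - altSign j

det : ∀ n → (Fin n → Fin n → Poly) → Poly
det zero    M = [ + 1 ]
det (suc n) M =
  sumP (λ j → scaleP (altSign j)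
                (M zero j *P det n (λ r c → M (suc r) (punchIn j c))))

charPoly : ∀ {n} → (Fin n → Fin n → ℤ) → Poly
charPoly {n} A = det n (λ i j →
  if ⌊ i ≟ j ⌋ then (- A i j) ∷ + 1 ∷ [] else (- A i j) ∷ [])

-- multiplicity of 0 as a root: number of vanishing lowest coefficients
-- (the characteristic polynomial is monic, so this is exact)
mult0 : Poly → ℕ
mult0 [] = 0
mult0 (+ zero ∷ p) = suc (mult0 p)
mult0 (_ ∷ p) = 0

η : ∀ {n} → SignedGraph n → ℕ
η Γ = mult0 (charPoly (adjMatrix Γ))

reach : ∀ {n} → SignedGraph n → ℕ → Fin n → Fin n → Bool
reach Γ zero    i j = ⌊ i ≟ j ⌋
reach Γ (suc k) i j = reach Γ k i j ∨ anyF (λ l → reach Γ k i l ∧ adj Γ l j)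

connectedᵇ : ∀ {n} → SignedGraph n → Fin n → Fin n → Bool
connectedᵇ {n} Γ i j = reach Γ n i j

Connected : ∀ {n} → SignedGraph n → Fin n → Fin n → Set
Connected Γ i j = connectedᵇ Γ i j ≡ true

-- ω(G): number of components = number of vertices that are the
-- least vertex of their component
ω : ∀ {n} → SignedGraph n → ℕ
ω Γ = countF (λ i → not (anyF (λ j → (toℕ j <ᵇ toℕ i) ∧ connectedᵇ Γ j i)))

sumF : ∀ {n} → (Fin n → ℕ) → ℕ
sumF {zero}  f = 0
sumF {suc n} f = f zero Data.Nat.+ sumF (λ i → f (suc i))

numEdges : ∀ {n} → SignedGraph n → ℕ
numEdges Γ = sumF (λ i → countF (λ j → (toℕ i <ᵇ toℕ j) ∧ adj Γ i j))

degree : ∀ {n} → SignedGraph n → Fin n → ℕ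
degree Γ i = countF (λ j → adj Γ i j)

pendants : ∀ {n} → SignedGraph n → ℕ
pendants Γ = countF (λ i → Data.Nat._≡ᵇ_ (degree Γ i) 1)

cyclomatic : ∀ {n} → SignedGraph n → ℤ
cyclomatic {n} Γ = (+ numEdges Γ ℤ.- + n) ℤ.+ + ω Γ

consecPairs : ∀ {A : Set} → List A → List (A × A)
consecPairs (x ∷ y ∷ r) = (x , y) ∷ consecPairs (y ∷ r)
consecPairs _ = []

closedPairs : ∀ {A : Set} → List A → List (A × A)
closedPairs [] = []
closedPairs (x ∷ r) = consecPairs ((x ∷ r) ++ [ x ])

record Cycle {n} (Γ : SignedGraph n) : Set where
  field
    verts    : List (Fin n)
    distinct : Unique verts
    long     : 3 ≤ length verts
    edges    : All (λ e → adj Γ (Data.Product.proj₁ e) (Data.Product.proj₂ e) ≡ true)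
                   (closedPairs verts)

open Cycle public

CycleEdge : ∀ {n} {Γ : SignedGraph n} → Cycle Γ → Fin n → Fin n → Set
CycleEdge C u v = ((u , v) ∈ closedPairs (verts C)) ⊎ ((v , u) ∈ closedPairs (verts C))

-- two cycles are the same subgraph iff they have the same edge set
SameCycle : ∀ {n} {Γ : SignedGraph n} → Cycle Γ → Cycle Γ → Set
SameCycle C D = ∀ u v → (CycleEdge C u v → CycleEdge D u v) × (CycleEdge D u v → CycleEdge C u v)

CycleDisjoint : ∀ {n} → SignedGraph n → Set
CycleDisjoint Γ = ∀ (C D : Cycle Γ) (v : Fin _) → v ∈ verts C → v ∈ verts D → SameCycle C D

CyclesShareVertex : ∀ {n} → SignedGraph n → Set
CyclesShareVertex Γ = Σ (Cycle Γ) λ C → Σ (Cycle Γ) λ D → ∃ λ v →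
  ¬ SameCycle C D × v ∈ verts C × v ∈ verts D

ComponentsNontrivial : ∀ {n} → SignedGraph n → Set
ComponentsNontrivial Γ = ∀ v → ∃ λ u → ¬ (u ≡ v) × Connected Γ u v

{-# OPTIONS --safe #-}
module Submission where

open import Defs
open import Algebra.Properties.CommutativeSemigroup using (x∙yz≈y∙xz; xy∙z≈xz∙y; interchange)
open import Data.Bool using (Bool; true; false; if_then_else_; _∧_; _∨_; not) renaming (T to IsTrue)
import Data.Bool.Properties as Boolₚ
open import Data.Empty using (⊥-elim)
open import Data.Fin using (Fin; zero; suc; toℕ; punchIn; punchOut; _≟_; splitAt; _↑ˡ_; _↑ʳ_)
open import Data.Fin.Properties using (any?; punchIn-punchOut; toℕ-injective)
open import Data.Integer as ℤ using (ℤ; +_; -[1+_]; -_; _+_; _*_; _^_; ∣_∣)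
open import Data.Integer.Properties as ℤₚ using (+-*-semiring; *-zeroʳ; *-zeroˡ; +-identityʳ; +-identityˡ; *-identityˡ; *-identityʳ; *-1-commutativeMonoid; i*j≡0⇒i≡0∨j≡0)
open import Data.Integer.Tactic.RingSolver using (solve-∀)
open import Data.List using (List; []; _∷_; _++_; [_])
open import Data.List.Membership.Propositional using (_∈_; find)
open import Data.List.Membership.Propositional.Properties using (∈-∃++; ∈-++⁻; ∈-++⁺ˡ)
open import Data.List.Properties using (++-assoc; ++-identityʳ)
open import Data.List.Relation.Binary.Permutation.Propositional using (_↭_; ↭⇒↭ₛ)
open import Data.List.Relation.Binary.Permutation.Propositional.Properties using (∈-resp-↭; ↭-length; ++-comm)
open import Data.List.Relation.Binary.Permutation.Setoid.Properties using (Unique-resp-↭)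
open import Data.List.Relation.Unary.All as All using (All; []; _∷_)
open import Data.List.Relation.Unary.All.Properties using (¬All⇒Any¬)
open import Data.List.Relation.Unary.AllPairs using (_∷_)
open import Data.List.Relation.Unary.Any using (here; there)
open import Data.List.Relation.Unary.Unique.Propositional using (Unique)
open import Data.Nat as ℕ using (ℕ; zero; suc; _≤_; z≤n; s≤s; _∸_; _<ᵇ_; _≡ᵇ_)
import Data.Nat.Divisibility as ℕ∣
import Data.Nat.Properties as ℕₚ
open import Data.Product using (_×_; _,_; proj₁; proj₂; ∃; Σ)
open import Data.Sum using (_⊎_; inj₁; inj₂; [_,_]′)
open import Data.Unit using (⊤; tt)
open import Data.Vec.Functional using (insertAt) renaming (_∷_ to infixr 5 _◂_; _++_ to _⧺_)
open import Data.Vec.Functional.Properties using (insertAt-lookup; insertAt-punchIn; lookup-++ˡ; lookup-++ʳ)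
open import Function using (_∘_)
open import Relation.Nullary using (yes; no; contradiction)
open import Relation.Nullary.Decidable using (⌊_⌋; ¬?; decidable-stable)
open import Relation.Binary.PropositionalEquality using (_≡_; _≢_; refl; sym; trans; cong; cong₂; subst; setoid; module ≡-Reasoning)
open import Algebra.Properties.Semiring.Sum +-*-semiring using (sum; sum-cong-≗; ∑-distrib-+; ∑-comm; sum-remove; *-distribˡ-sum; *-distribʳ-sum; sum-replicate-zero)
open import Algebra.Properties.CommutativeMonoid.Sum *-1-commutativeMonoid using () renaming (sum to product; sum-remove to product-remove)
open ≡-Reasoning

-- Evaluating the characteristic polynomial of a symmetric integer matrix A at
-- integers t, and comparing det (tI - A) with the determinant of its product with
-- a matrix whose columns are kernel vectors and unit vectors, shows that the
-- multiplicity of 0 is at most |S| whenever a kernel vector vanishing on S is zero.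
--
-- By the handshake lemma, 2c + p = 2ω + Σ (deg v - 2) over the vertices of degree
-- at least 2.  A set S of this size is found by a graph search: each component
-- starts with the two ends of an edge in S, and whenever the neighbours of a
-- reached vertex v are visited, all new ones except the last go into S (the
-- equation of A x = 0 at v forces the last entry).  As v has a visited neighbour
-- already, at most deg v - 2 vertices are added.  One vertex is saved by starting
-- at a pendant vertex, whose neighbour is forced, or, in the third case, by
-- handling a vertex w of degree at least 3 on a cycle only after both neighbours
-- of w on the cycle have been visited.

-- Determinants

-- The nullity is read off the coefficients of the characteristic polynomial, while the search
-- controls only kernel vectors; for a general matrix the multiplicity of 0 can exceed the dimension
-- of the kernel. Symmetry closes this gap: kernel and image of `A` meet only in 0, because
-- `w = A u` and `A w = 0` give `w · w = 0`. No theory of rank or bases is set up. Instead a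
-- determining set is shrunk until no element can be removed; each remaining element then owns a
-- kernel vector that vanishes at the others. With these vectors as columns, one factor `t` comes
-- out of each. If `t` occurred more often in the value at `t`, the determinant left over, which is
-- congruent modulo `t` to a fixed nonzero integer, would be divisible by `t`; letting `t` run over
-- all positive integers refutes this without leaving the integers. The determinant is given only by
-- expansion along row 0, so its behaviour under products is derived from the uniqueness of
-- alternating functions. On the graph side the charge is attached to single vertices, so the order
-- of processing is free; the third case uses this freedom.

Row : ℕ → Set
Row m = Fin m → ℤ

δ : ∀ {n} → Fin n → Row n
δ zero    zero    = + 1
δ zero    (suc j) = + 0
δ (suc i) zero    = + 0
δ (suc i) (suc j) = δ i j

sum-zero : ∀ {n} (f : Row n) → (∀ i → f i ≡ + 0) → sum f ≡ + 0
sum-zero {n} f f≗0 = trans (sum-cong-≗ f≗0) (sum-replicate-zero n)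

sum-linear : ∀ {n} a (f g : Row n) → sum (λ i → a * f i + g i) ≡ a * sum f + sum g
sum-linear a f g =
  trans (∑-distrib-+ (λ i → a * f i) g) (cong (_+ sum g) (sym (*-distribˡ-sum a f)))

-- Alternating functions of the rows of a matrix

module _ {m : ℕ} where

  -- Matrices are functions, and pointwise equal ones need not be propositionally equal; so each
  -- function of matrices carries this property along.
  Extensional : ∀ {n} → ((Fin n → Row m) → ℤ) → Set
  Extensional f = ∀ {M N} → (∀ i j → M i j ≡ N i j) → f M ≡ f N

  Linear₀ : ∀ {n} → ((Fin (suc n) → Row m) → ℤ) → Set
  Linear₀ f = ∀ a u v T → f ((λ j → a * u j + v j) ◂ T) ≡ a * f (u ◂ T) + f (v ◂ T)

  Repeat₀ : ∀ n → ((Fin (suc n) → Row m) → ℤ) → Set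
  Repeat₀ zero    f = ⊤
  Repeat₀ (suc n) f = ∀ r T → f (r ◂ r ◂ T) ≡ + 0

  -- Linearity in every row and vanishing on equal adjacent rows, phrased for the leading rows and
  -- then recursively with the first row fixed. This is the form in which expansion along row 0
  -- delivers it; equal rows further apart are handled by `repeat`.
  Alternating : ∀ n → ((Fin n → Row m) → ℤ) → Set
  Alternating zero    f = ⊤
  Alternating (suc n) f =
    Linear₀ f × Repeat₀ n f × (∀ r → Alternating n (λ T → f (r ◂ T)))

  ◂-cong : ∀ {n} {u v : Row m} {S T : Fin n → Row m} →
    (∀ j → u j ≡ v j) → (∀ i j → S i j ≡ T i j) → ∀ i j → (u ◂ S) i j ≡ (v ◂ T) i j
  ◂-cong p q zero    = p
  ◂-cong p q (suc i) = q i

  ◂-η : ∀ {n} (M : Fin (suc n) → Row m) → ∀ i j → M i j ≡ (M zero ◂ M ∘ suc) i j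
  ◂-η M zero    j = refl
  ◂-η M (suc i) j = refl

  extensional-tail : ∀ {n} {f : (Fin (suc n) → Row m) → ℤ} →
    Extensional f → ∀ r → Extensional (λ T → f (r ◂ T))
  extensional-tail ext r p = ext (◂-cong (λ _ → refl) p)

  alternating-resp : ∀ n {f g : (Fin n → Row m) → ℤ} →
    (∀ T → f T ≡ g T) → Alternating n f → Alternating n g
  alternating-resp zero    eq _ = tt
  alternating-resp (suc n) {f} {g} eq (lin , rep , tail) =
    (λ a u v T → trans (sym (eq _))
                   (trans (lin a u v T) (cong₂ (λ x y → a * x + y) (eq _) (eq _)))) ,
    repeat n rep eq ,
    (λ r → alternating-resp n (λ T → eq _) (tail r))
    where
    repeat : ∀ n {f g : (Fin (suc n) → Row m) → ℤ} →
      Repeat₀ n f → (∀ T → f T ≡ g T) → Repeat₀ n g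
    repeat zero    _   _  = tt
    repeat (suc n) rep eq r T = trans (sym (eq _)) (rep r T)

  alternating-sum : ∀ n {k} (c : Row k) (f : Fin k → (Fin n → Row m) → ℤ) →
    (∀ j → Alternating n (f j)) → Alternating n (λ T → sum (λ j → c j * f j T))
  alternating-sum zero    c f alt = tt
  alternating-sum (suc n) {k} c f alt =
    (λ a u v T → trans
        (sum-cong-≗ (λ j → trans (cong (c j *_) (proj₁ (alt j) a u v T))
                                 (shuffle (c j) a (f j (u ◂ T)) (f j (v ◂ T)))))
        (sum-linear a (λ j → c j * f j (u ◂ T)) (λ j → c j * f j (v ◂ T)))) ,
    repeat n (λ j → proj₁ (proj₂ (alt j))) ,
    (λ r → alternating-sum n c _ (λ j → proj₂ (proj₂ (alt j)) r))
    where
    shuffle : ∀ c a x y → c * (a * x + y) ≡ a * (c * x) + c * y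
    shuffle = solve-∀
    repeat : ∀ n {f : Fin k → (Fin (suc n) → Row m) → ℤ} →
      (∀ j → Repeat₀ n (f j)) → Repeat₀ n (λ T → sum (λ j → c j * f j T))
    repeat zero    _   = tt
    repeat (suc n) {f} rep r T =
      sum-zero (λ j → c j * f j (r ◂ r ◂ T)) (λ j → trans (cong (c j *_) (rep j r T)) (*-zeroʳ (c j)))

  -- Polarisation: expand `f` on two copies of `u + v` and drop the terms with a repeated row. The
  -- coefficient `+ 1` in `w` fits the sum to the shape of `Linear₀`.
  swap₀ : ∀ {n} (f : (Fin (suc (suc n)) → Row m) → ℤ) → Alternating (suc (suc n)) f →
    ∀ u v T → f (u ◂ v ◂ T) ≡ - f (v ◂ u ◂ T)
  swap₀ f (lin , rep , tail) u v T = begin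
    f (u ◂ v ◂ T)
      ≡⟨ isolate uu uv vu vv ⟩
    ((+ 1 * (+ 1 * uu + uv)) + (+ 1 * vu + vv)) + (- uu) + (- vv) + (- vu)
      ≡⟨ cong (λ x → x + - uu + - vv + - vu) expand ⟨
    f (w ◂ w ◂ T) + (- uu) + (- vv) + (- vu)
      ≡⟨ cong₂ (λ x y → x + - uu + y + - vu) (rep w T) (cong -_ (rep v T)) ⟩
    + 0 + (- uu) + + 0 + (- vu)
      ≡⟨ cong (λ x → + 0 + - x + + 0 + - vu) (rep u T) ⟩
    + 0 + (- vu)
      ≡⟨ +-identityˡ _ ⟩
    - vu ∎
    where
    w : Row m
    w j = + 1 * u j + v j
    uu = f (u ◂ u ◂ T)
    uv = f (u ◂ v ◂ T)
    vu = f (v ◂ u ◂ T)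
    vv = f (v ◂ v ◂ T)
    isolate : ∀ a b c d → b ≡ ((+ 1 * (+ 1 * a + b)) + (+ 1 * c + d)) + (- a) + (- d) + (- c)
    isolate = solve-∀
    expand : f (w ◂ w ◂ T) ≡ (+ 1 * (+ 1 * uu + uv)) + (+ 1 * vu + vv)
    expand = trans (lin (+ 1) u v (w ◂ T))
      (cong₂ (λ x y → + 1 * x + y) (proj₁ (tail u) (+ 1) u v T) (proj₁ (tail v) (+ 1) u v T))

  repeat : ∀ {n} {f : (Fin (suc n) → Row m) → ℤ} → Extensional f → Alternating (suc n) f →
    ∀ r T i → (∀ j → T i j ≡ r j) → f (r ◂ T) ≡ + 0
  repeat {suc n} ext (lin , rep , tail) r T zero Tᵢ≗r =
    trans (ext (◂-cong (λ _ → refl) (λ i j → trans (◂-η T i j) (◂-cong Tᵢ≗r (λ _ _ → refl) i j))))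
          (rep r (T ∘ suc))
  repeat {suc n} {f} ext alt@(lin , rep , tail) r T (suc i) Tᵢ≗r = begin
    f (r ◂ T)                    ≡⟨ ext (◂-cong (λ _ → refl) (◂-η T)) ⟩
    f (r ◂ T zero ◂ T ∘ suc)     ≡⟨ swap₀ f alt r (T zero) (T ∘ suc) ⟩
    - f (T zero ◂ r ◂ T ∘ suc)
      ≡⟨ cong -_ (repeat (extensional-tail ext (T zero)) (tail (T zero)) r (T ∘ suc) i Tᵢ≗r) ⟩
    + 0 ∎

  -- By linearity each row splits off a multiple of a value with `e` as a row, which vanishes. With
  -- `e = δ j` under a first row `δ j` this clears column `j`.
  absorb : ∀ n {f : (Fin n → Row m) → ℤ} → Extensional f → Alternating n f →
    ∀ (e : Row m) → (∀ T i → (∀ j → T i j ≡ e j) → f T ≡ + 0) →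
    ∀ (c : Row n) T → f (λ i j → c i * e j + T i j) ≡ f T
  absorb zero    ext alt e vanish c T = ext (λ ())
  absorb (suc n) {f} ext (lin , rep , tail) e vanish c T = begin
    f (λ i j → c i * e j + T i j)
      ≡⟨ ext (◂-η _) ⟩
    f ((λ j → c zero * e j + T zero j) ◂ T′)
      ≡⟨ lin (c zero) e (T zero) T′ ⟩
    c zero * f (e ◂ T′) + f (T zero ◂ T′)
      ≡⟨ cong (λ x → c zero * x + f (T zero ◂ T′)) (vanish _ zero (λ _ → refl)) ⟩
    c zero * + 0 + f (T zero ◂ T′)
      ≡⟨ cong (_+ f (T zero ◂ T′)) (*-zeroʳ (c zero)) ⟩
    + 0 + f (T zero ◂ T′)
      ≡⟨ +-identityˡ _ ⟩
    f (T zero ◂ T′)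
      ≡⟨ absorb n (extensional-tail ext (T zero)) (tail (T zero)) e
           (λ S i eq → vanish _ (suc i) eq) (c ∘ suc) (T ∘ suc) ⟩
    f (T zero ◂ T ∘ suc)
      ≡⟨ ext (◂-η T) ⟨
    f T ∎
    where
    T′ : Fin n → Row m
    T′ i j = c (suc i) * e j + T (suc i) j

  -- Row `j` passes the `j` rows above it, at the cost of one sign each.
  bring-to-front : ∀ {n} {f : (Fin (suc n) → Row m) → ℤ} → Extensional f → Alternating (suc n) f →
    ∀ (R : Fin (suc n) → Row m) j → f (R j ◂ R ∘ punchIn j) ≡ altSign j * f R
  bring-to-front {f = f} ext alt R zero =
    trans (sym (ext (◂-η R))) (sym (*-identityˡ (f R)))
  bring-to-front {suc n} {f} ext alt@(lin , rep , tail) R (suc j) = begin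
    f (R (suc j) ◂ R ∘ punchIn (suc j))
      ≡⟨ ext (◂-cong (λ _ → refl) (◂-η _)) ⟩
    f (R (suc j) ◂ R zero ◂ R ∘ suc ∘ punchIn j)
      ≡⟨ swap₀ f alt (R (suc j)) (R zero) (R ∘ suc ∘ punchIn j) ⟩
    - f (R zero ◂ R (suc j) ◂ R ∘ suc ∘ punchIn j)
      ≡⟨ cong -_ (bring-to-front (extensional-tail ext (R zero)) (tail (R zero)) (R ∘ suc) j) ⟩
    - (altSign j * f (R zero ◂ R ∘ suc))
      ≡⟨ ℤₚ.neg-distribˡ-* (altSign j) _ ⟩
    - altSign j * f (R zero ◂ R ∘ suc)
      ≡⟨ cong (- altSign j *_) (ext (◂-η R)) ⟨
    - altSign j * f R ∎

record LinearMap (k m : ℕ) : Set where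
  field
    map  : Row k → Row m
    resp : ∀ {u v} → (∀ j → u j ≡ v j) → ∀ j → map u j ≡ map v j
    lin  : ∀ a u v j → map (λ i → a * u i + v i) j ≡ a * map u j + map v j

extensional-∘ : ∀ {n k m} (L : LinearMap k m) {f : (Fin n → Row m) → ℤ} → Extensional f →
  Extensional (λ T → f (λ i → LinearMap.map L (T i)))
extensional-∘ L ext eq = ext (λ i → LinearMap.resp L (eq i))

alternating-∘ : ∀ n {k m} (L : LinearMap k m) {f : (Fin n → Row m) → ℤ} → Extensional f →
  Alternating n f → Alternating n (λ T → f (λ i → LinearMap.map L (T i)))
alternating-∘ zero L ext alt = tt
alternating-∘ (suc n) {k} {m} L {f} ext (lin , rep , tail) =
  (λ a u v T → trans (ext (λ { zero → L.lin a u v ; (suc i) j → refl }))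
                 (trans (lin a (L.map u) (L.map v) (λ i → L.map (T i)))
                   (cong₂ (λ x y → a * x + y) (push u T) (push v T)))) ,
  repeat′ n ext rep ,
  (λ r → alternating-resp n (push r)
           (alternating-∘ n L (extensional-tail ext (L.map r)) (tail (L.map r))))
  where
  module L = LinearMap L
  push : ∀ u T → f (L.map u ◂ λ i → L.map (T i)) ≡ f (λ i → L.map ((u ◂ T) i))
  push u T = ext (λ { zero j → refl ; (suc i) j → refl })
  repeat′ : ∀ n {f : (Fin (suc n) → Row m) → ℤ} → Extensional f → Repeat₀ n f →
    Repeat₀ n (λ T → f (λ i → L.map (T i)))
  repeat′ zero    ext rep = tt
  repeat′ (suc n) ext rep r T =
    trans (ext (λ { zero j → refl ; (suc zero) j → refl ; (suc (suc i)) j → refl }))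
          (rep (L.map r) (λ i → L.map (T i)))

linear-expansion : ∀ {m} (g : Row m → ℤ) → (∀ {u v} → (∀ j → u j ≡ v j) → g u ≡ g v) →
  (∀ a u v → g (λ j → a * u j + v j) ≡ a * g u + g v) →
  ∀ r → g r ≡ sum (λ j → r j * g (δ j))
-- All rows of length 0 agree pointwise, so linearity yields `g r = g r + g r`, which forces the
-- value 0 of the empty sum.
linear-expansion {zero} g ext lin r = begin
  g r                       ≡⟨ cancel (g r) (g r) ⟩
  (+ 1 * g r + g r) + - g r ≡⟨ cong (_+ - g r) (lin (+ 1) r r) ⟨
  g (λ j → + 1 * r j + r j) + - g r ≡⟨ cong (_+ - g r) (ext (λ ())) ⟩
  g r + - g r               ≡⟨ ℤₚ.+-inverseʳ (g r) ⟩
  + 0 ∎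
  where
  cancel : ∀ x y → x ≡ (+ 1 * x + y) + - y
  cancel = solve-∀
linear-expansion {suc m} g ext lin r = begin
  g r
    ≡⟨ ext (λ { zero → split (r zero) ; (suc j) → split′ (r zero) (r (suc j)) }) ⟩
  g (λ j → r zero * δ zero j + (+ 0 ◂ r ∘ suc) j)
    ≡⟨ lin (r zero) (δ zero) (+ 0 ◂ r ∘ suc) ⟩
  r zero * g (δ zero) + g (+ 0 ◂ r ∘ suc)
    ≡⟨ cong (λ x → r zero * g (δ zero) + x) (linear-expansion (λ u → g (+ 0 ◂ u))
         (λ eq → ext (λ { zero → refl ; (suc j) → eq j }))
         (λ a u v → trans (ext (λ { zero → zeros a ; (suc j) → refl })) (lin a _ _)) (r ∘ suc)) ⟩
  r zero * g (δ zero) + sum (λ j → r (suc j) * g (+ 0 ◂ δ j))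
    ≡⟨ cong (λ x → r zero * g (δ zero) + x) (sum-cong-≗ (λ j → cong (r (suc j) *_)
         (ext {+ 0 ◂ δ j} {δ (suc j)} (λ { zero → refl ; (suc _) → refl })))) ⟩
  r zero * g (δ zero) + sum (λ j → r (suc j) * g (δ (suc j))) ∎
  where
  split : ∀ x → x ≡ x * + 1 + + 0
  split = solve-∀
  split′ : ∀ x y → y ≡ x * + 0 + y
  split′ = solve-∀
  zeros : ∀ a → + 0 ≡ a * + 0 + + 0
  zeros = solve-∀

-- The recursion of `det` with integers for polynomials, so that evaluation commutes with it term by
-- term.
detℤ : ∀ n → (Fin n → Row n) → ℤ
detℤ zero    M = + 1
detℤ (suc n) M =
  sum (λ j → altSign j * (M zero j * detℤ n (λ r c → M (suc r) (punchIn j c))))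

detℤ-ext : ∀ n → Extensional (detℤ n)
detℤ-ext zero    eq = refl
detℤ-ext (suc n) eq = sum-cong-≗ (λ j → cong (altSign j *_)
  (cong₂ _*_ (eq zero j) (detℤ-ext n (λ r c → eq (suc r) (punchIn j c)))))

delete-column : ∀ {m} → Fin (suc m) → LinearMap (suc m) m
delete-column j = record
  { map  = _∘ punchIn j
  ; resp = λ eq i → eq (punchIn j i)
  ; lin  = λ a u v i → refl
  }

-- A map `ρ` records which columns a minor keeps. When neither deleted column is column 0, the kept
-- columns are a `lift` of a choice among the others; this is the shape of the recursive step below.
lift : ∀ {m n} → (Fin m → Fin n) → Fin (suc m) → Fin (suc n)
lift ρ zero    = zero
lift ρ (suc i) = suc (ρ i)

-- The terms with j = 0 cancel those with k = 0; what remains is the same sum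
-- over the other columns.
alternating-double-sum : ∀ m (r : Row (suc (suc m))) (D : (Fin m → Fin (suc (suc m))) → ℤ) →
  (∀ {ρ σ} → (∀ i → ρ i ≡ σ i) → D ρ ≡ D σ) →
  sum (λ j → altSign j * (r j *
    sum (λ k → altSign k * (r (punchIn j k) * D (punchIn j ∘ punchIn k))))) ≡ + 0
alternating-double-sum m r D ext = begin
  + 1 * (r zero * sum (λ k → altSign k * (r (suc k) * D (suc ∘ punchIn k))))
    + sum (λ j → - altSign j * (r (suc j) *
        (+ 1 * (r zero * D (punchIn (suc j) ∘ suc)) + B j)))
    ≡⟨ cong₂ _+_ first (trans (sum-cong-≗ second) (sum-linear (- r zero)
         (λ j → altSign j * (r (suc j) * D (suc ∘ punchIn j)))
         (λ j → altSign j * (r (suc j) * - B j)))) ⟩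
  r zero * X + (- r zero * X + sum (λ j → altSign j * (r (suc j) * - B j)))
    ≡⟨ cancel (r zero) X (sum (λ j → altSign j * (r (suc j) * - B j))) ⟩
  sum (λ j → altSign j * (r (suc j) * - B j))
    ≡⟨ rest m r D ext ⟩
  + 0 ∎
  where
  B : Fin (suc m) → ℤ
  B j = sum (λ k → - altSign k * (r (punchIn (suc j) (suc k)) * D (punchIn (suc j) ∘ punchIn (suc k))))
  X = sum (λ k → altSign k * (r (suc k) * D (suc ∘ punchIn k)))
  first : + 1 * (r zero * X) ≡ r zero * X
  first = *-identityˡ _
  shuffle : ∀ s a b d e → - s * (a * (+ 1 * (b * d) + e)) ≡ - b * (s * (a * d)) + s * (a * - e)
  shuffle = solve-∀
  second : ∀ j → - altSign j * (r (suc j) * (+ 1 * (r zero * D (punchIn (suc j) ∘ suc)) + B j))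
    ≡ - r zero * (altSign j * (r (suc j) * D (suc ∘ punchIn j))) + altSign j * (r (suc j) * - B j)
  second j = shuffle (altSign j) (r (suc j)) (r zero) (D (suc ∘ punchIn j)) (B j)
  cancel : ∀ a x y → a * x + (- a * x + y) ≡ y
  cancel = solve-∀
  rest : ∀ m (r : Row (suc (suc m))) (D : (Fin m → Fin (suc (suc m))) → ℤ) →
    (∀ {ρ σ} → (∀ i → ρ i ≡ σ i) → D ρ ≡ D σ) →
    sum {suc m} (λ j → altSign j * (r (suc j) *
      - sum {m} (λ k → - altSign k *
          (r (punchIn (suc j) (suc k)) * D (punchIn (suc j) ∘ punchIn (suc k)))))) ≡ + 0
  rest zero    r D ext = cong (λ x → + 1 * x + + 0) (*-zeroʳ (r (suc zero)))
  rest (suc m) r D ext = trans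
    (sum-cong-≗ (λ j → cong (λ x → altSign j * (r (suc j) * x)) (begin
      - sum (λ k → - altSign k * (r (suc (punchIn j k)) * D (punchIn (suc j) ∘ punchIn (suc k))))
        ≡⟨ ℤₚ.-1*i≡-i _ ⟨
      - (+ 1) * sum (λ k → - altSign k * (r (suc (punchIn j k)) * D (punchIn (suc j) ∘ punchIn (suc k))))
        ≡⟨ *-distribˡ-sum (- (+ 1)) (λ k → - altSign k * (r (suc (punchIn j k)) * D (punchIn (suc j) ∘ punchIn (suc k)))) ⟩
      sum (λ k → - (+ 1) * (- altSign k * (r (suc (punchIn j k)) * D (punchIn (suc j) ∘ punchIn (suc k)))))
        ≡⟨ sum-cong-≗ (λ k → trans (neg-neg (altSign k) (r (suc (punchIn j k)) * D (punchIn (suc j) ∘ punchIn (suc k))))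
             (cong (λ x → altSign k * (r (suc (punchIn j k)) * x)) 
               (ext {punchIn (suc j) ∘ punchIn (suc k)} {lift (punchIn j ∘ punchIn k)} (λ { zero → refl ; (suc i) → refl })))) ⟩
      sum (λ k → altSign k * (r (suc (punchIn j k)) * D (lift (punchIn j ∘ punchIn k)))) ∎)))
    (alternating-double-sum m (r ∘ suc) (D ∘ lift)
      (λ eq → ext (λ { zero → refl ; (suc i) → cong suc (eq i) })))
    where
    neg-neg : ∀ s x → - (+ 1) * (- s * x) ≡ s * x
    neg-neg = solve-∀

-- Expansion along row 0 is linear in that row, and the minors inherit the property through deletion
-- of a column. For equal first rows, expanding twice gives a sum over ordered pairs of distinct
-- columns, which `alternating-double-sum` cancels.
detℤ-alternating : ∀ n → Alternating n (detℤ n)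
detℤ-alternating zero    = tt
detℤ-alternating (suc n) =
  (λ a u v T → trans (sum-cong-≗ (λ j → shuffle (altSign j) a (u j) (v j) (minor T j)))
     (sum-linear a (λ j → altSign j * (u j * minor T j)) (λ j → altSign j * (v j * minor T j)))) ,
  repeat′ n ,
  (λ r → alternating-resp n
     (λ T → sum-cong-≗ (λ j → ℤₚ.*-assoc (altSign j) (r j) (minor T j)))
     (alternating-sum n (λ j → altSign j * r j) (λ j T → minor T j)
       (λ j → alternating-∘ n (delete-column j) (detℤ-ext n) (detℤ-alternating n))))
  where
  minor : (Fin n → Row (suc n)) → Row (suc n)
  minor T j = detℤ n (λ i c → T i (punchIn j c))
  shuffle : ∀ s a u v d → s * ((a * u + v) * d) ≡ a * (s * (u * d)) + s * (v * d)
  shuffle = solve-∀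
  repeat′ : ∀ n → Repeat₀ n (detℤ (suc n))
  repeat′ zero    = tt
  repeat′ (suc n) r T = alternating-double-sum n r
    (λ ρ → detℤ n (λ i c → T i (ρ c)))
    (λ eq → detℤ-ext n (λ i c → cong (T i) (eq c)))

insert-zero : ∀ {m} → Fin (suc m) → LinearMap m (suc m)
insert-zero j = record
  { map  = λ r → insertAt r j (+ 0)
  ; resp = resp j
  ; lin  = lin j
  }
  where
  resp : ∀ {m} (j : Fin (suc m)) {u v : Row m} → (∀ i → u i ≡ v i) →
    ∀ i → insertAt u j (+ 0) i ≡ insertAt v j (+ 0) i
  resp         zero    eq zero    = refl
  resp         zero    eq (suc i) = eq i
  resp {suc m} (suc j) eq zero    = eq zero
  resp {suc m} (suc j) eq (suc i) = resp j (eq ∘ suc) i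
  zeros : ∀ a → + 0 ≡ a * + 0 + + 0
  zeros = solve-∀
  lin : ∀ {m} (j : Fin (suc m)) a (u v : Row m) i →
    insertAt (λ i → a * u i + v i) j (+ 0) i ≡ a * insertAt u j (+ 0) i + insertAt v j (+ 0) i
  lin         zero    a u v zero    = zeros a
  lin         zero    a u v (suc i) = refl
  lin {suc m} (suc j) a u v zero    = refl
  lin {suc m} (suc j) a u v (suc i) = lin j a (u ∘ suc) (v ∘ suc) i

split-column : ∀ {m} (j : Fin (suc m)) (r : Row (suc m)) i →
  r i ≡ r j * δ j i + insertAt (r ∘ punchIn j) j (+ 0) i
split-column zero r zero = at (r zero)
  where
  at : ∀ x → x ≡ x * + 1 + + 0
  at = solve-∀
split-column zero r (suc i) = off (r zero) (r (suc i))
  where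
  off : ∀ x y → y ≡ x * + 0 + y
  off = solve-∀
split-column {suc m} (suc j) r zero = off (r (suc j)) (r zero)
  where
  off : ∀ x y → y ≡ x * + 0 + y
  off = solve-∀
split-column {suc m} (suc j) r (suc i) = split-column j (r ∘ suc) i

insert-δ : ∀ {m} (j : Fin (suc m)) k i → insertAt (δ k) j (+ 0) i ≡ δ (punchIn j k) i
insert-δ         zero    k       zero    = refl
insert-δ         zero    k       (suc i) = refl
insert-δ {suc m} (suc j) zero    zero    = refl
insert-δ {suc m} (suc j) (suc k) zero    = refl
insert-δ {suc m} (suc j) zero    (suc i) = zeros j i
  where
  zeros : ∀ {m} (j : Fin (suc m)) i → insertAt (λ _ → + 0) j (+ 0) i ≡ + 0
  zeros         zero    zero    = refl
  zeros         zero    (suc i) = refl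
  zeros {suc m} (suc j) zero    = refl
  zeros {suc m} (suc j) (suc i) = zeros j i
insert-δ {suc m} (suc j) (suc k) (suc i) = insert-δ j k i

-- Expand row 0 into unit vectors. Under a first row `δ j`, `absorb` clears column `j`, so the value
-- is an alternating function of the minor; by induction it is determined by its value at the
-- identity, which is `altSign j * f δ` after moving row `j` to the front. What results is the
-- expansion defining `detℤ`, times `f δ`.
alternating-unique : ∀ n {f : (Fin n → Row n) → ℤ} → Extensional f → Alternating n f →
  ∀ M → f M ≡ f δ * detℤ n M
alternating-unique zero    {f} ext alt M = trans (ext (λ ())) (sym (*-identityʳ (f δ)))
alternating-unique (suc n) {f} ext alt@(lin , rep , tail) M = begin
  f M
    ≡⟨ ext (◂-η M) ⟩
  f (M zero ◂ T)
    ≡⟨ linear-expansion (λ r → f (r ◂ T)) (λ eq → ext (◂-cong eq (λ _ _ → refl)))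
         (λ a u v → lin a u v T) (M zero) ⟩
  sum (λ j → M zero j * f (δ j ◂ T))
    ≡⟨ sum-cong-≗ (λ j → trans (cong (M zero j *_) (minor j)) (shuffle (M zero j) (altSign j) (f δ) _)) ⟩
  sum (λ j → f δ * (altSign j * (M zero j * detℤ n (λ r c → T r (punchIn j c)))))
    ≡⟨ *-distribˡ-sum (f δ) (λ j → altSign j * (M zero j * detℤ n (λ r c → T r (punchIn j c)))) ⟨
  f δ * detℤ (suc n) M ∎
  where
  T = M ∘ suc
  shuffle : ∀ x s d e → x * ((s * d) * e) ≡ d * (s * (x * e))
  shuffle = solve-∀
  g : Fin (suc n) → (Fin n → Row n) → ℤ
  g j N = f (δ j ◂ λ i → insertAt (N i) j (+ 0))
  g-δ : ∀ j → g j δ ≡ altSign j * f δ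
  g-δ j = trans (ext (◂-cong (λ _ → refl) (insert-δ j))) (bring-to-front ext alt δ j)
  minor : ∀ j → f (δ j ◂ T) ≡ (altSign j * f δ) * detℤ n (λ r c → T r (punchIn j c))
  minor j = begin
    f (δ j ◂ T)
      ≡⟨ ext (◂-cong (λ _ → refl) (λ i → split-column j (T i))) ⟩
    f (δ j ◂ λ i c → T i j * δ j c + insertAt (T i ∘ punchIn j) j (+ 0) c)
      ≡⟨ absorb n (extensional-tail ext (δ j)) (tail (δ j)) (δ j)
           (λ S i eq → repeat ext alt (δ j) S i eq) (λ i → T i j) _ ⟩
    g j (λ r c → T r (punchIn j c))
      ≡⟨ alternating-unique n
           (extensional-∘ (insert-zero j) (extensional-tail ext (δ j)))
           (alternating-∘ n (insert-zero j) (extensional-tail ext (δ j)) (tail (δ j))) _ ⟩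
    g j δ * detℤ n (λ r c → T r (punchIn j c))
      ≡⟨ cong (_* detℤ n (λ r c → T r (punchIn j c))) (g-δ j) ⟩
    (altSign j * f δ) * detℤ n (λ r c → T r (punchIn j c)) ∎

-- Dot products, matrix products and their determinants

dot : ∀ {n} → Row n → Row n → ℤ
dot r v = sum (λ j → r j * v j)

dot-cong : ∀ {n} {r s u v : Row n} → (∀ j → r j ≡ s j) → (∀ j → u j ≡ v j) → dot r u ≡ dot s v
dot-cong p q = sum-cong-≗ (λ j → cong₂ _*_ (p j) (q j))

dot-linearˡ : ∀ {n} a (u v w : Row n) → dot (λ j → a * u j + v j) w ≡ a * dot u w + dot v w
dot-linearˡ a u v w = trans (sum-cong-≗ (λ j → expand a (u j) (v j) (w j)))
                            (sum-linear a (λ j → u j * w j) (λ j → v j * w j))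
  where
  expand : ∀ a u v w → (a * u + v) * w ≡ a * (u * w) + v * w
  expand = solve-∀

dot-comm : ∀ {n} (u v : Row n) → dot u v ≡ dot v u
dot-comm u v = sum-cong-≗ (λ j → ℤₚ.*-comm (u j) (v j))

dot-zeroʳ : ∀ {n} (u v : Row n) → (∀ j → v j ≡ + 0) → dot u v ≡ + 0
dot-zeroʳ u v v≗0 = sum-zero (λ j → u j * v j)
  (λ j → trans (cong (u j *_) (v≗0 j)) (*-zeroʳ (u j)))

dot-δˡ : ∀ {n} (i : Fin n) (v : Row n) → dot (δ i) v ≡ v i
dot-δˡ zero    v = trans (cong₂ _+_ (*-identityˡ (v zero))
                           (sum-zero (λ j → + 0 * v (suc j)) (λ j → *-zeroˡ (v (suc j)))))
                         (+-identityʳ (v zero))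
dot-δˡ (suc i) v = trans (cong₂ _+_ (*-zeroˡ (v zero)) (dot-δˡ i (v ∘ suc)))
                         (+-identityˡ (v (suc i)))

dot-remove : ∀ {n} (j : Fin (suc n)) (r v : Row (suc n)) →
  dot r v ≡ r j * v j + dot (r ∘ punchIn j) (v ∘ punchIn j)
dot-remove j r v = sum-remove {i = j} (λ i → r i * v i)

δ-diag : ∀ {n} (i : Fin n) → δ i i ≡ + 1
δ-diag zero    = refl
δ-diag (suc i) = δ-diag i

δ-off : ∀ {n} (i j : Fin n) → i ≢ j → δ i j ≡ + 0
δ-off zero    zero    i≢j = contradiction refl i≢j
δ-off zero    (suc j) i≢j = refl
δ-off (suc i) zero    i≢j = refl
δ-off (suc i) (suc j) i≢j = δ-off i j (i≢j ∘ cong suc)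

δ-sym : ∀ {n} (i j : Fin n) → δ i j ≡ δ j i
δ-sym zero    zero    = refl
δ-sym zero    (suc j) = refl
δ-sym (suc i) zero    = refl
δ-sym (suc i) (suc j) = δ-sym i j

infixl 7 _·_

_·_ : ∀ {n m k} → (Fin n → Row m) → (Fin m → Row k) → Fin n → Row k
(M · P) i j = dot (M i) (λ l → P l j)

right-mul : ∀ {k m} → (Fin k → Row m) → LinearMap k m
right-mul P = record
  { map  = λ r j → dot r (λ l → P l j)
  ; resp = λ eq j → dot-cong eq (λ _ → refl)
  ; lin  = λ a u v j → dot-linearˡ a u v (λ l → P l j)
  }

-- As a function of the rows of `M`, the left side is alternating, hence a multiple of the
-- determinant. The divisibility arguments below rest on the factor being an integer.
detℤ-· : ∀ n (P : Fin n → Row n) → ∃ λ c → ∀ M → detℤ n (M · P) ≡ c * detℤ n M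
detℤ-· n P = detℤ n (δ · P) ,
  alternating-unique n (extensional-∘ (right-mul P) (detℤ-ext n))
    (alternating-∘ n (right-mul P) (detℤ-ext n) (detℤ-alternating n))

detℤ-δ : ∀ n → detℤ n δ ≡ + 1
detℤ-δ zero    = refl
detℤ-δ (suc n) = cong₂ _+_ (cong (λ x → + 1 * (+ 1 * x)) (detℤ-δ n))
  (sum-zero (λ j → altSign (suc j) * (+ 0 * minor j))
    (λ j → trans (cong (altSign (suc j) *_) (*-zeroˡ (minor j))) (*-zeroʳ (altSign (suc j)))))
  where
  minor : Row n
  minor j = detℤ n (λ r c → δ (suc r) (punchIn (suc j) c))

detℤ-scale-columns : ∀ n (c : Row n) M → detℤ n (λ i j → M i j * c j) ≡ product c * detℤ n M
detℤ-scale-columns zero    c M = refl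
detℤ-scale-columns (suc n) c M = trans
  (sum-cong-≗ (λ j → begin
    altSign j * (M zero j * c j * detℤ n (λ r k → M (suc r) (punchIn j k) * c (punchIn j k)))
      ≡⟨ cong (λ x → altSign j * (M zero j * c j * x)) (detℤ-scale-columns n (c ∘ punchIn j) _) ⟩
    altSign j * (M zero j * c j * (product (c ∘ punchIn j) * minor j))
      ≡⟨ shuffle (altSign j) (M zero j) (c j) (product (c ∘ punchIn j)) (minor j) ⟩
    c j * product (c ∘ punchIn j) * (altSign j * (M zero j * minor j))
      ≡⟨ cong (_* (altSign j * (M zero j * minor j))) (product-remove {i = j} c) ⟨
    product c * (altSign j * (M zero j * minor j)) ∎))
  (sym (*-distribˡ-sum (product c) (λ j → altSign j * (M zero j * minor j))))
  where
  minor : Row (suc n)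
  minor j = detℤ n (λ r k → M (suc r) (punchIn j k))
  shuffle : ∀ s m c p d → s * (m * c * (p * d)) ≡ c * p * (s * (m * d))
  shuffle = solve-∀

-- A congruence modulo `t` with its quotient `e` made explicit; it links the determinants of
-- `reduced t` and `reduced (+ 0)`.
detℤ-mod : ∀ t n (M E : Fin n → Row n) →
  ∃ λ e → detℤ n (λ i j → t * E i j + M i j) ≡ t * e + detℤ n M
detℤ-mod t zero    M E = + 0 , cong (_+ + 1) (sym (*-zeroʳ t))
detℤ-mod t (suc n) M E = sum e , trans
  (sum-cong-≗ (λ j → trans
    (cong (λ x → altSign j * ((t * E zero j + M zero j) * x)) (proj₂ (rec j)))
    (shuffle t (altSign j) (E zero j) (M zero j) (minor j) (proj₁ (rec j)))))
  (sum-linear t e (λ j → altSign j * (M zero j * minor j)))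
  where
  minor : Row (suc n)
  minor j = detℤ n (λ r k → M (suc r) (punchIn j k))
  rec : ∀ j → ∃ λ e → detℤ n (λ r k → t * E (suc r) (punchIn j k) + M (suc r) (punchIn j k))
                      ≡ t * e + minor j
  rec j = detℤ-mod t n (λ r k → M (suc r) (punchIn j k)) (λ r k → E (suc r) (punchIn j k))
  e : Row (suc n)
  e j = altSign j * (E zero j * (t * proj₁ (rec j) + minor j) + M zero j * proj₁ (rec j))
  shuffle : ∀ t s x m d e → s * ((t * x + m) * (t * e + d))
    ≡ t * (s * (x * (t * e + d) + m * e)) + s * (m * d)
  shuffle = solve-∀

-- Values of polynomials at integers

eval : ℤ → Poly → ℤ
eval t []      = + 0
eval t (a ∷ p) = a + t * eval t p

eval-+P : ∀ t p q → eval t (p +P q) ≡ eval t p + eval t q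
eval-+P t []      q       = sym (+-identityˡ (eval t q))
eval-+P t (a ∷ p) []      = sym (+-identityʳ (a + t * eval t p))
eval-+P t (a ∷ p) (b ∷ q) =
  trans (cong (λ x → a + b + t * x) (eval-+P t p q)) (shuffle t a b (eval t p) (eval t q))
  where
  shuffle : ∀ t a b p q → a + b + t * (p + q) ≡ a + t * p + (b + t * q)
  shuffle = solve-∀

eval-scaleP : ∀ t c p → eval t (scaleP c p) ≡ c * eval t p
eval-scaleP t c []      = sym (*-zeroʳ c)
eval-scaleP t c (a ∷ p) =
  trans (cong (λ x → c * a + t * x) (eval-scaleP t c p)) (shuffle t a c (eval t p))
  where
  shuffle : ∀ t a c p → c * a + t * (c * p) ≡ c * (a + t * p)
  shuffle = solve-∀

eval-*P : ∀ t p q → eval t (p *P q) ≡ eval t p * eval t q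
eval-*P t []      q = sym (*-zeroˡ (eval t q))
eval-*P t (a ∷ p) q = begin
  eval t (scaleP a q +P (+ 0 ∷ (p *P q)))
    ≡⟨ eval-+P t (scaleP a q) (+ 0 ∷ (p *P q)) ⟩
  eval t (scaleP a q) + (+ 0 + t * eval t (p *P q))
    ≡⟨ cong₂ (λ x y → x + (+ 0 + t * y)) (eval-scaleP t a q) (eval-*P t p q) ⟩
  a * eval t q + (+ 0 + t * (eval t p * eval t q))
    ≡⟨ shuffle t a (eval t p) (eval t q) ⟩
  (a + t * eval t p) * eval t q ∎
  where
  shuffle : ∀ t a p q → a * q + (+ 0 + t * (p * q)) ≡ (a + t * p) * q
  shuffle = solve-∀

eval-sumP : ∀ t {n} (f : Fin n → Poly) → eval t (sumP f) ≡ sum (λ i → eval t (f i))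
eval-sumP t {zero}  f = refl
eval-sumP t {suc n} f = trans (eval-+P t (f zero) (sumP (f ∘ suc)))
  (cong (λ x → eval t (f zero) + x) (eval-sumP t (f ∘ suc)))

eval-det : ∀ t n (M : Fin n → Fin n → Poly) → eval t (det n M) ≡ detℤ n (λ i j → eval t (M i j))
eval-det t zero    M = cong (λ x → + 1 + x) (*-zeroʳ t)
eval-det t (suc n) M = trans (eval-sumP t (λ j → scaleP (altSign j) (M zero j *P minor j)))
  (sum-cong-≗ (λ j → trans (eval-scaleP t (altSign j) (M zero j *P minor j))
    (cong (altSign j *_) (trans (eval-*P t (M zero j) (minor j))
      (cong (eval t (M zero j) *_) (eval-det t n (λ r c → M (suc r) (punchIn j c))))))))
  where
  minor : Fin (suc n) → Poly
  minor j = det n (λ r c → M (suc r) (punchIn j c))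

eval-mult0 : ∀ t p → ∃ λ q → eval t p ≡ t ^ mult0 p * q
eval-mult0 t []             = + 0 , refl
eval-mult0 t (+ zero ∷ p)   =
  let q , eq = eval-mult0 t p
  in q , trans (+-identityˡ (t * eval t p))
           (trans (cong (t *_) eq) (sym (ℤₚ.*-assoc t (t ^ mult0 p) q)))
eval-mult0 t (+ suc a ∷ p)  = _ , sym (*-identityˡ (+ suc a + t * eval t p))
eval-mult0 t (-[1+ a ] ∷ p) = _ , sym (*-identityˡ (-[1+ a ] + t * eval t p))

eval-charPoly : ∀ t {n} (A : Fin n → Row n) →
  eval t (charPoly A) ≡ detℤ n (λ i j → t * δ i j + - A i j)
eval-charPoly t {n} A = trans (eval-det t n _) (detℤ-ext n (λ i j → entry i j (- A i j)))
  where
  on : ∀ t a → a + t * (+ 1 + t * + 0) ≡ t * + 1 + a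
  on = solve-∀
  off : ∀ t a → a + t * + 0 ≡ t * + 0 + a
  off = solve-∀
  entry : ∀ i j a → eval t (if ⌊ i ≟ j ⌋ then a ∷ + 1 ∷ [] else a ∷ []) ≡ t * δ i j + a
  entry i j a with i ≟ j
  ... | yes refl = trans (on t a) (cong (λ x → t * x + a) (sym (δ-diag i)))
  ... | no  i≢j  = trans (off t a) (cong (λ x → t * x + a) (sym (δ-off i j i≢j)))

-- Kernels and elimination over the integers

Kernel : ∀ {m n} → (Fin m → Row n) → Row n → Set
Kernel M v = ∀ i → dot (M i) v ≡ + 0

Injective : ∀ {m n} → (Fin m → Row n) → Set
Injective M = ∀ v → Kernel M v → ∀ i → v i ≡ + 0

*-≢0-cancel : ∀ {a b} → a ≢ + 0 → a * b ≡ + 0 → b ≡ + 0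
*-≢0-cancel {a} a≢0 ab≡0 = [ (λ a≡0 → contradiction a≡0 a≢0) , (λ b≡0 → b≡0) ]′ (i*j≡0⇒i≡0∨j≡0 a ab≡0)

-- Fraction-free Gaussian elimination.
kernel-or-injective : ∀ m {n} (M : Fin m → Row n) →
  (∃ λ v → Kernel M v × ∃ λ i → v i ≢ + 0) ⊎ (n ≤ m × Injective M)
kernel-or-injective m       {zero}  M = inj₂ (z≤n , λ _ _ ())
kernel-or-injective zero    {suc n} M = inj₁ (δ zero , (λ ()) , zero , λ ())
kernel-or-injective (suc m) {suc n} M with any? (λ j → ¬? (M zero j ℤ.≟ + 0))
... | no ∄pivot with kernel-or-injective m (M ∘ suc)
...   | inj₁ (v , ker , nonzero) = inj₁ (v , (λ { zero → row₀ ; (suc i) → ker i }) , nonzero)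
  where
  row₀ : dot (M zero) v ≡ + 0
  row₀ = trans (dot-comm (M zero) v) (dot-zeroʳ v (M zero)
    (λ j → decidable-stable (M zero j ℤ.≟ + 0) (λ M₀ⱼ≢0 → ∄pivot (j , M₀ⱼ≢0))))
...   | inj₂ (n≤m , inj) = inj₂ (ℕₚ.m≤n⇒m≤1+n n≤m , λ v ker → inj v (ker ∘ suc))
kernel-or-injective (suc m) {suc n} M | yes (j , a≢0) =
  [ (λ { (w , ker , i , wᵢ≢0) → inj₁ (extend w , extend-kernel w ker , punchIn j i , extend-≢0 w i wᵢ≢0) })
  , (λ { (n≤m , inj) → inj₂ (s≤s n≤m , injective inj) })
  ]′ (kernel-or-injective m M′)
  where
  a = M zero j
  r = M zero ∘ punchIn j
  M′ : Fin m → Row n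
  M′ i c = a * M (suc i) (punchIn j c) + - M (suc i) j * r c

  M′-dot : ∀ i w → dot (M′ i) w ≡ a * dot (M (suc i) ∘ punchIn j) w + - M (suc i) j * dot r w
  M′-dot i w = trans (dot-linearˡ a (M (suc i) ∘ punchIn j) (λ c → - M (suc i) j * r c) w)
    (cong (λ x → a * dot (M (suc i) ∘ punchIn j) w + x)
      (trans (sum-cong-≗ (λ c → ℤₚ.*-assoc (- M (suc i) j) (r c) (w c)))
             (sym (*-distribˡ-sum (- M (suc i) j) (λ c → r c * w c)))))

  -- Back substitution without division: scaling `w` by the pivot `a` makes `- dot r w` the
  -- coordinate at `j` that solves the pivot row.
  extend : Row n → Row (suc n)
  extend w = insertAt (λ c → a * w c) j (- dot r w)

  extend-dot : ∀ s w → dot s (extend w) ≡ s j * - dot r w + a * dot (s ∘ punchIn j) w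
  extend-dot s w = trans (dot-remove j s (extend w)) (cong₂ _+_
    (cong (s j *_) (insertAt-lookup (λ c → a * w c) j (- dot r w)))
    (trans (sum-cong-≗ (λ c → trans
              (cong (s (punchIn j c) *_) (insertAt-punchIn (λ c → a * w c) j (- dot r w) c))
              (swap (s (punchIn j c)) a (w c))))
           (sym (*-distribˡ-sum a (λ c → s (punchIn j c) * w c)))))
    where
    swap : ∀ x y z → x * (y * z) ≡ y * (x * z)
    swap = solve-∀

  extend-kernel : ∀ w → Kernel M′ w → Kernel M (extend w)
  extend-kernel w ker zero = trans (extend-dot (M zero) w) (cancel a (dot r w))
    where
    cancel : ∀ a x → a * - x + a * x ≡ + 0
    cancel = solve-∀
  extend-kernel w ker (suc i) = begin
    dot (M (suc i)) (extend w)
      ≡⟨ extend-dot (M (suc i)) w ⟩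
    M (suc i) j * - dot r w + a * dot (M (suc i) ∘ punchIn j) w
      ≡⟨ rearrange (M (suc i) j) (dot r w) a (dot (M (suc i) ∘ punchIn j) w) ⟩
    a * dot (M (suc i) ∘ punchIn j) w + - M (suc i) j * dot r w
      ≡⟨ M′-dot i w ⟨
    dot (M′ i) w
      ≡⟨ ker i ⟩
    + 0 ∎
    where
    rearrange : ∀ m x a y → m * - x + a * y ≡ a * y + - m * x
    rearrange = solve-∀

  rest : Injective M′ → ∀ v → Kernel M v → ∀ c → v (punchIn j c) ≡ + 0
  rest inj v ker = inj (v ∘ punchIn j) (λ i → trans (M′-dot i (v ∘ punchIn j)) (trans
    (cong₂ (λ x y → a * x + - M (suc i) j * y) (solve-dot (suc i)) (solve-dot zero))
    (cancel a (M (suc i) j) (v j))))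
    where
    isolate : ∀ x y → y ≡ (x + y) + - x
    isolate = solve-∀
    cancel : ∀ a m v → a * - (m * v) + - m * - (a * v) ≡ + 0
    cancel = solve-∀
    solve-dot : ∀ i → dot (M i ∘ punchIn j) (v ∘ punchIn j) ≡ - (M i j * v j)
    solve-dot i = begin
      dot (M i ∘ punchIn j) (v ∘ punchIn j)
        ≡⟨ isolate (M i j * v j) (dot (M i ∘ punchIn j) (v ∘ punchIn j)) ⟩
      (M i j * v j + dot (M i ∘ punchIn j) (v ∘ punchIn j)) + - (M i j * v j)
        ≡⟨ cong (_+ - (M i j * v j)) (trans (sym (dot-remove j (M i) v)) (ker i)) ⟩
      + 0 + - (M i j * v j)
        ≡⟨ +-identityˡ (- (M i j * v j)) ⟩
      - (M i j * v j) ∎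

  extend-≢0 : ∀ w i → w i ≢ + 0 → extend w (punchIn j i) ≢ + 0
  extend-≢0 w i wᵢ≢0 eq = wᵢ≢0 (*-≢0-cancel a≢0
    (trans (sym (insertAt-punchIn (λ c → a * w c) j (- dot r w) i)) eq))

  injective : Injective M′ → Injective M
  injective inj v ker i with j ≟ i
  ... | no  j≢i  = trans (cong v (sym (punchIn-punchOut j≢i))) (rest inj v ker (punchOut j≢i))
  ... | yes refl = *-≢0-cancel a≢0 (begin
    a * v j
      ≡⟨ +-identityʳ (a * v j) ⟨
    a * v j + + 0
      ≡⟨ cong (λ x → a * v j + x) (dot-zeroʳ r (v ∘ punchIn j) (rest inj v ker)) ⟨
    a * v j + dot r (v ∘ punchIn j)
      ≡⟨ dot-remove j (M zero) v ⟨
    dot (M zero) v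
      ≡⟨ ker zero ⟩
    + 0 ∎)

product-≢0 : ∀ {n} (c : Row n) → (∀ i → c i ≢ + 0) → product c ≢ + 0
product-≢0 {zero}  c c≢0 ()
product-≢0 {suc n} c c≢0 eq = product-≢0 (c ∘ suc) (c≢0 ∘ suc) (*-≢0-cancel (c≢0 zero) eq)

-- N Q is diagonal with nonzero diagonal for a suitable Q.
injective⇒detℤ≢0 : ∀ n (N : Fin n → Row n) → Injective N → detℤ n N ≢ + 0
injective⇒detℤ≢0 n N inj det≡0 = product-≢0 d d≢0 (begin
  product d
    ≡⟨ *-identityʳ (product d) ⟨
  product d * + 1
    ≡⟨ cong (product d *_) (detℤ-δ n) ⟨
  product d * detℤ n δ
    ≡⟨ detℤ-scale-columns n d δ ⟨
  detℤ n (λ i j → δ i j * d j)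
    ≡⟨ detℤ-ext n (λ i j → N·Q i j) ⟨
  detℤ n (N · Q)
    ≡⟨ proj₂ (detℤ-· n Q) N ⟩
  proj₁ (detℤ-· n Q) * detℤ n N
    ≡⟨ cong (proj₁ (detℤ-· n Q) *_) det≡0 ⟩
  proj₁ (detℤ-· n Q) * + 0
    ≡⟨ *-zeroʳ (proj₁ (detℤ-· n Q)) ⟩
  + 0 ∎)
  where
  -- A kernel vector of this matrix, which has more columns than rows, expresses a multiple of the
  -- unit vector `δ j` as `N` applied to its tail. Injectivity of `N` keeps the multiple nonzero;
  -- the tail becomes column `j` of `Q`, the multiple the entry `d j`.
  augmented : Fin n → Fin n → Row (suc n)
  augmented j i = δ j i ◂ N i
  relation : ∀ j → ∃ λ v → Kernel (augmented j) v × v zero ≢ + 0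
  relation j with kernel-or-injective n (augmented j)
  ... | inj₂ (n<n , _) = ⊥-elim (ℕₚ.n≮n n n<n)
  ... | inj₁ (v , ker , i , vᵢ≢0) = v , ker , λ v₀≡0 → vᵢ≢0 (vanish v₀≡0 i)
    where
    vanish : v zero ≡ + 0 → ∀ i → v i ≡ + 0
    vanish v₀≡0 zero    = v₀≡0
    vanish v₀≡0 (suc i) = inj (v ∘ suc) (λ k → begin
      dot (N k) (v ∘ suc)
        ≡⟨ +-identityˡ (dot (N k) (v ∘ suc)) ⟨
      + 0 + dot (N k) (v ∘ suc)
        ≡⟨ cong (_+ dot (N k) (v ∘ suc)) (trans (cong (δ j k *_) v₀≡0) (*-zeroʳ (δ j k))) ⟨
      dot (augmented j k) v
        ≡⟨ ker k ⟩
      + 0 ∎) i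
  Q : Fin n → Row n
  Q i j = proj₁ (relation j) (suc i)
  d : Row n
  d j = - proj₁ (relation j) zero
  d≢0 : ∀ j → d j ≢ + 0
  d≢0 j eq = proj₂ (proj₂ (relation j)) (trans (sym (ℤₚ.neg-involutive (proj₁ (relation j) zero))) (cong -_ eq))
  N·Q : ∀ i j → (N · Q) i j ≡ δ i j * d j
  N·Q i j = begin
    (N · Q) i j
      ≡⟨ isolate (δ j i) (proj₁ (relation j) zero) ((N · Q) i j) ⟩
    dot (augmented j i) (proj₁ (relation j)) + δ j i * d j
      ≡⟨ cong₂ _+_ (proj₁ (proj₂ (relation j)) i) (cong (_* d j) (δ-sym j i)) ⟩
    + 0 + δ i j * d j
      ≡⟨ +-identityˡ (δ i j * d j) ⟩
    δ i j * d j ∎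
    where
    isolate : ∀ x v y → y ≡ (x * v + y) + x * - v
    isolate = solve-∀

-- Determining sets and the multiplicity of the eigenvalue 0

infixl 6 _∖_

_∖_ : ∀ {n} → (Fin n → Bool) → Fin n → Fin n → Bool
(P ∖ i) j = P j ∧ not ⌊ i ≟ j ⌋

∖-other : ∀ {n} (P : Fin n → Bool) {i j} → i ≢ j → P j ≡ true → (P ∖ i) j ≡ true
∖-other P {i} {j} i≢j Pⱼ with P j | i ≟ j
... | true  | yes i≡j = contradiction i≡j i≢j
... | true  | no  _   = refl

countF-cong : ∀ {n} {P Q : Fin n → Bool} → (∀ i → P i ≡ Q i) → countF P ≡ countF Q
countF-cong {zero}  eq = refl
countF-cong {suc n} eq =
  cong₂ (λ b c → (if b then 1 else 0) ℕ.+ c) (eq zero) (countF-cong (eq ∘ suc))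

∖-suc : ∀ {n} (P : Fin (suc n) → Bool) i j → ((P ∘ suc) ∖ i) j ≡ (P ∖ suc i) (suc j)
∖-suc P i j with i ≟ j
... | yes _ = refl
... | no  _ = refl

countF-∖ : ∀ {n} (P : Fin n → Bool) i → P i ≡ true → countF P ≡ suc (countF (P ∖ i))
countF-∖ P zero    Pᵢ with P zero
... | true  = cong suc (countF-cong λ j → ∧-true (P (suc j)))
  where
  ∧-true : ∀ b → b ≡ b ∧ true
  ∧-true true  = refl
  ∧-true false = refl
countF-∖ P (suc i) Pᵢ with P zero
... | true  = cong suc (trans (countF-∖ (P ∘ suc) i Pᵢ) (cong suc (countF-cong (∖-suc P i))))
... | false = trans (countF-∖ (P ∘ suc) i Pᵢ) (cong suc (countF-cong (∖-suc P i)))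

sum-of-squares : ∀ {n} (w : Row n) → dot w w ≡ + 0 → ∀ i → w i ≡ + 0
sum-of-squares w eq i = ℤₚ.∣i∣≡0⇒i≡0 (square-zero (sumF-zero _ (ℤₚ.+-injective (trans (sym (abs w)) eq)) i))
  where
  square : ∀ x → x * x ≡ + (∣ x ∣ ℕ.* ∣ x ∣)
  square (+ x)    = sym (ℤₚ.pos-* x x)
  square -[1+ x ] = refl
  abs : ∀ {n} (w : Row n) → dot w w ≡ + sumF (λ i → ∣ w i ∣ ℕ.* ∣ w i ∣)
  abs {zero}  w = refl
  abs {suc n} w = cong₂ _+_ (square (w zero)) (abs (w ∘ suc))
  sumF-zero : ∀ {n} (f : Fin n → ℕ) → sumF f ≡ 0 → ∀ i → f i ≡ 0
  sumF-zero f eq zero    = ℕₚ.m+n≡0⇒m≡0 (f zero) eq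
  sumF-zero f eq (suc i) = sumF-zero (f ∘ suc) (ℕₚ.m+n≡0⇒n≡0 (f zero) eq) i
  square-zero : ∀ {m} → m ℕ.* m ≡ 0 → m ≡ 0
  square-zero {zero} _ = refl

Determining : ∀ {n} → (Fin n → Row n) → (Fin n → Bool) → Set
Determining A S = ∀ x → Kernel A x → (∀ i → S i ≡ true → x i ≡ + 0) → ∀ i → x i ≡ + 0

-- Elimination is applied to `A` with the unit rows of `S` stacked below it, padded by zero rows:
-- its kernel consists of the kernel vectors of `A` that vanish on `S`.
determining? : ∀ {n} (A : Fin n → Row n) S → Determining A S ⊎
  (∃ λ x → Kernel A x × (∀ i → S i ≡ true → x i ≡ + 0) × ∃ λ i → x i ≢ + 0)
determining? {n} A S with kernel-or-injective (n ℕ.+ n) (A ⧺ U)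
  where
  U : Fin n → Row n
  U i = if S i then δ i else (λ _ → + 0)
... | inj₁ (x , ker , nonzero) = inj₂ (x ,
        (λ i → trans (cong (λ r → dot r x) (sym (lookup-++ˡ A _ i))) (ker (i ↑ˡ n))) ,
        (λ i Sᵢ → trans (sym (dot-δˡ i x)) (trans
          (cong (λ b → dot (if b then δ i else (λ _ → + 0)) x) (sym Sᵢ))
          (trans (cong (λ r → dot r x) (sym (lookup-++ʳ A _ i))) (ker (n ↑ʳ i))))) ,
        nonzero)
... | inj₂ (_ , inj) = inj₁ (λ x ker vanish → inj x (λ k → rows x ker vanish (splitAt n k)))
  where
  units : ∀ x b i → (b ≡ true → x i ≡ + 0) → dot (if b then δ i else (λ _ → + 0)) x ≡ + 0
  units x true  i vanish = trans (dot-δˡ i x) (vanish refl)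
  units x false i vanish = sum-zero (λ j → + 0 * x j) (λ j → *-zeroˡ (x j))
  rows : ∀ x → Kernel A x → (∀ i → S i ≡ true → x i ≡ + 0) →
    ∀ k → dot (Data.Sum.[ A , (λ i → if S i then δ i else (λ _ → + 0)) ] k) x ≡ + 0
  rows x ker vanish (inj₁ i) = ker i
  rows x ker vanish (inj₂ i) = units x (S i) i (vanish i)

-- A member of a dual basis for the coordinates in `F`, up to a factor: over the integers `K f`
-- cannot be normalised to 1.
IsDual : ∀ {n} → (Fin n → Row n) → (Fin n → Bool) → Fin n → Row n → Set
IsDual A F f K = Kernel A K × K f ≢ + 0 × (∀ i → F i ≡ true → f ≢ i → K i ≡ + 0)

some-or-all : ∀ {n} {P Q : Fin n → Set} → (∀ i → P i ⊎ Q i) → ∃ P ⊎ (∀ i → Q i)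
some-or-all {zero}  dec = inj₂ (λ ())
some-or-all {suc n} dec with dec zero | some-or-all (dec ∘ suc)
... | inj₁ p | _            = inj₁ (zero , p)
... | inj₂ q | inj₁ (i , p) = inj₁ (suc i , p)
... | inj₂ q | inj₂ qs      = inj₂ (λ { zero → q ; (suc i) → qs i })

-- Remove elements as long as the set stays determining. If `i` cannot be removed, some nonzero
-- kernel vector vanishes on all other elements; it is nonzero at `i`, since the set with `i` is
-- determining. So minimality alone produces the dual vectors.
minimal-determining : ∀ {n} (A : Fin n → Row n) k S → countF S ≡ k → Determining A S →
  ∃ λ F → countF F ≤ k × Determining A F × (∀ f → F f ≡ true → ∃ (IsDual A F f))
minimal-determining {n} A k S #S det with some-or-all step
  where
  step : ∀ i → (S i ≡ true × Determining A (S ∖ i)) ⊎ (S i ≡ true → ∃ (IsDual A S i))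
  step i with S i in Sᵢ | determining? A (S ∖ i)
  ... | false | _         = inj₂ (λ ())
  ... | true  | inj₁ det′ = inj₁ (refl , det′)
  ... | true  | inj₂ (x , ker , vanish , j , xⱼ≢0) = inj₂ (λ _ → x , ker ,
          (λ xᵢ≡0 → xⱼ≢0 (det x ker (λ l Sₗ → at l Sₗ xᵢ≡0) j)) ,
          (λ l Sₗ i≢l → vanish l (∖-other S i≢l Sₗ)))
    where
    at : ∀ l → S l ≡ true → x i ≡ + 0 → x l ≡ + 0
    at l Sₗ xᵢ≡0 with i ≟ l
    ... | yes refl = xᵢ≡0
    ... | no  i≢l  = vanish l (∖-other S i≢l Sₗ)
... | inj₂ dual = S , ℕₚ.≤-reflexive #S , det , dual
... | inj₁ (i , Sᵢ , det′) with k
...   | zero  = contradiction (trans (sym (countF-∖ S i Sᵢ)) #S) λ ()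
...   | suc k with minimal-determining A k (S ∖ i) (ℕₚ.suc-injective (trans (sym (countF-∖ S i Sᵢ)) #S)) det′
...     | F , F≤k , rest = F , ℕₚ.m≤n⇒m≤1+n F≤k , rest

product-indicator : ∀ t {n} (F : Fin n → Bool) →
  product (λ j → if F j then t else + 1) ≡ t ^ countF F
product-indicator t {zero}  F = refl
product-indicator t {suc n} F with F zero
... | true  = cong (t *_) (product-indicator t (F ∘ suc))
... | false = trans (*-identityˡ (product (λ j → if F (suc j) then t else + 1))) (product-indicator t (F ∘ suc))

-- A nonzero `z` is not divisible by `∣ z ∣ + 1`, so the hypothesis at `s = ∣ z ∣` decides.
all-divide⇒≡0 : ∀ z → (∀ s → ∃ λ q → z ≡ + suc s * q) → z ≡ + 0
all-divide⇒≡0 z divides with z ℤ.≟ + 0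
... | yes z≡0 = z≡0
... | no  z≢0 with divides ∣ z ∣
...   | q , eq = ⊥-elim (ℕₚ.n≮n ∣ z ∣ (ℕ∣.∣⇒≤ {{ℕ.≢-nonZero (z≢0 ∘ ℤₚ.∣i∣≡0⇒i≡0)}}
          (ℕ∣.divides ∣ q ∣ (trans (cong ∣_∣ eq) (trans (ℤₚ.abs-* (+ suc ∣ z ∣) q) (ℕₚ.*-comm (suc ∣ z ∣) ∣ q ∣))))))

Symmetric : ∀ {n} → (Fin n → Row n) → Set
Symmetric A = ∀ i j → A i j ≡ A j i

self-adjoint : ∀ {n} (A : Fin n → Row n) → Symmetric A → ∀ u w →
  dot w (λ i → dot (A i) u) ≡ dot (λ j → dot (A j) w) u
self-adjoint A A-sym u w = begin
  sum (λ i → w i * sum (λ j → A i j * u j))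
    ≡⟨ sum-cong-≗ (λ i → *-distribˡ-sum (w i) (λ j → A i j * u j)) ⟩
  sum (λ i → sum (λ j → w i * (A i j * u j)))
    ≡⟨ ∑-comm (λ i j → w i * (A i j * u j)) ⟩
  sum (λ j → sum (λ i → w i * (A i j * u j)))
    ≡⟨ sum-cong-≗ (λ j → sum-cong-≗ (λ i →
         trans (cong (λ a → w i * (a * u j)) (A-sym i j)) (shuffle (w i) (A j i) (u j)))) ⟩
  sum (λ j → sum (λ i → (A j i * w i) * u j))
    ≡⟨ sum-cong-≗ (λ j → *-distribʳ-sum (u j) (λ i → A j i * w i)) ⟨
  sum (λ j → sum (λ i → A j i * w i) * u j) ∎
  where
  shuffle : ∀ w a u → w * (a * u) ≡ (a * w) * u
  shuffle = solve-∀

module _ {n} (A : Fin n → Row n) (A-sym : Symmetric A) (F : Fin n → Bool)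
  (F-det : Determining A F) (K : Fin n → Row n) (dual : ∀ f → F f ≡ true → IsDual A F f (K f)) where

  basis : Fin n → Row n
  basis i j = if F j then K j i else δ i j

  -- The product of `charMatrix t` and `basis` after a factor `t` is taken out of every column in
  -- `F`, where `A K = 0` leaves only `t K`. Unlike that product it stays nonsingular at `t = 0`.
  reduced : ℤ → Fin n → Row n
  reduced t i j = if F j then K j i else t * δ i j + - A i j

  charMatrix : ℤ → Fin n → Row n
  charMatrix t i j = t * δ i j + - A i j

  charMatrix-dot : ∀ t i x → dot (charMatrix t i) x ≡ t * x i + - dot (A i) x
  charMatrix-dot t i x = trans (dot-linearˡ t (δ i) (λ j → - A i j) x)
    (cong₂ (λ a b → t * a + b) (dot-δˡ i x) (begin
      sum (λ j → - A i j * x j)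
        ≡⟨ sum-cong-≗ (λ j → neg (A i j) (x j)) ⟩
      sum (λ j → - (+ 1) * (A i j * x j))
        ≡⟨ *-distribˡ-sum (- (+ 1)) (λ j → A i j * x j) ⟨
      - (+ 1) * dot (A i) x
        ≡⟨ ℤₚ.-1*i≡-i (dot (A i) x) ⟩
      - dot (A i) x ∎))
    where
    neg : ∀ a x → - a * x ≡ - (+ 1) * (a * x)
    neg = solve-∀

  charMatrix-basis : ∀ t i j →
    (charMatrix t · basis) i j ≡ reduced t i j * (if F j then t else + 1)
  charMatrix-basis t i j with F j in Fⱼ
  ... | true  = begin
    dot (charMatrix t i) (K j)       ≡⟨ charMatrix-dot t i (K j) ⟩
    t * K j i + - dot (A i) (K j)    ≡⟨ cong (λ x → t * K j i + - x) (proj₁ (dual j Fⱼ) i) ⟩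
    t * K j i + + 0                  ≡⟨ +-identityʳ (t * K j i) ⟩
    t * K j i                        ≡⟨ ℤₚ.*-comm t (K j i) ⟩
    K j i * t ∎
  ... | false = begin
    dot (charMatrix t i) (λ l → δ l j)
      ≡⟨ dot-comm (charMatrix t i) (λ l → δ l j) ⟩
    dot (λ l → δ l j) (charMatrix t i)
      ≡⟨ dot-cong (λ l → δ-sym l j) (λ _ → refl) ⟩
    dot (δ j) (charMatrix t i)
      ≡⟨ dot-δˡ j (charMatrix t i) ⟩
    charMatrix t i j
      ≡⟨ *-identityʳ (charMatrix t i j) ⟨
    charMatrix t i j * + 1 ∎

  reduced-mod : ∀ t → ∃ λ e → detℤ n (reduced t) ≡ t * e + detℤ n (reduced (+ 0))
  reduced-mod t =
    let e , eq = detℤ-mod t n (reduced (+ 0)) (λ i j → if F j then + 0 else δ i j)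
    in e , trans (detℤ-ext n entry) eq
    where
    on : ∀ t x → x ≡ t * + 0 + x
    on = solve-∀
    off : ∀ t d a → t * d + - a ≡ t * d + (+ 0 * d + - a)
    off = solve-∀
    entry : ∀ i j → reduced t i j ≡ t * (if F j then + 0 else δ i j) + reduced (+ 0) i j
    entry i j with F j
    ... | true  = on t (K j i)
    ... | false = off t (δ i j) (A i j)

  -- If w = A u with w in the kernel of the symmetric matrix A, then w · w = (A w) · u = 0.
  reduced-injective : Injective (reduced (+ 0))
  reduced-injective b ker = b≡0
    where
    -- The vector `b` is split: `w` combines the dual vectors with the coefficients in `F`, `u`
    -- keeps the rest, and the kernel equation becomes `w = A u`. Once `w = 0`, `u` is a kernel
    -- vector vanishing on `F`, and duality reads the coefficients in `F` off `w`.
    u w : Row n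
    u j = if F j then + 0 else b j
    w i = sum (λ j → (if F j then K j i else + 0) * b j)

    split : ∀ i → dot (reduced (+ 0) i) b ≡ w i + - dot (A i) u
    split i = trans (sum-cong-≗ entry) (trans
      (sum-linear (- (+ 1)) (λ j → A i j * u j) (λ j → (if F j then K j i else + 0) * b j))
      (rearrange (dot (A i) u) (w i)))
      where
      rearrange : ∀ x y → - (+ 1) * x + y ≡ y + - x
      rearrange = solve-∀
      on : ∀ a k b → k * b ≡ - (+ 1) * (a * + 0) + k * b
      on = solve-∀
      off : ∀ d a b → (+ 0 * d + - a) * b ≡ - (+ 1) * (a * b) + + 0 * b
      off = solve-∀
      entry : ∀ j → reduced (+ 0) i j * b j
        ≡ - (+ 1) * (A i j * u j) + (if F j then K j i else + 0) * b j
      entry j with F j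
      ... | true  = on (A i j) (K j i) (b j)
      ... | false = off (δ i j) (A i j) (b j)

    w≡Au : ∀ i → w i ≡ dot (A i) u
    w≡Au i = ℤₚ.i-j≡0⇒i≡j (w i) (dot (A i) u) (trans (sym (split i)) (ker i))

    Aw≡0 : ∀ i → dot (A i) w ≡ + 0
    Aw≡0 i = begin
      sum (λ l → A i l * sum (λ j → (if F j then K j l else + 0) * b j))
        ≡⟨ sum-cong-≗ (λ l → *-distribˡ-sum (A i l) (λ j → (if F j then K j l else + 0) * b j)) ⟩
      sum (λ l → sum (λ j → A i l * ((if F j then K j l else + 0) * b j)))
        ≡⟨ ∑-comm (λ l j → A i l * ((if F j then K j l else + 0) * b j)) ⟩
      sum (λ j → sum (λ l → A i l * ((if F j then K j l else + 0) * b j)))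
        ≡⟨ sum-zero _ column ⟩
      + 0 ∎
      where
      column : ∀ j → sum (λ l → A i l * ((if F j then K j l else + 0) * b j)) ≡ + 0
      column j with F j in Fⱼ
      ... | true  = begin
        sum (λ l → A i l * (K j l * b j)) ≡⟨ sum-cong-≗ (λ l → ℤₚ.*-assoc (A i l) (K j l) (b j)) ⟨
        sum (λ l → A i l * K j l * b j)   ≡⟨ *-distribʳ-sum (b j) (λ l → A i l * K j l) ⟨
        dot (A i) (K j) * b j             ≡⟨ cong (_* b j) (proj₁ (dual j Fⱼ) i) ⟩
        + 0 * b j                         ≡⟨ *-zeroˡ (b j) ⟩
        + 0 ∎
      ... | false = dot-zeroʳ (A i) (λ _ → + 0 * b j) (λ _ → *-zeroˡ (b j))

    w≡0 : ∀ i → w i ≡ + 0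
    w≡0 = sum-of-squares w (begin
      dot w w                           ≡⟨ dot-cong {r = w} (λ _ → refl) w≡Au ⟩
      dot w (λ i → dot (A i) u)         ≡⟨ self-adjoint A A-sym u w ⟩
      dot (λ j → dot (A j) w) u         ≡⟨ dot-comm (λ j → dot (A j) w) u ⟩
      dot u (λ j → dot (A j) w)         ≡⟨ dot-zeroʳ u (λ j → dot (A j) w) Aw≡0 ⟩
      + 0 ∎)

    u≡0 : ∀ i → u i ≡ + 0
    u≡0 = F-det u (λ i → trans (sym (w≡Au i)) (w≡0 i)) vanish
      where
      vanish : ∀ i → F i ≡ true → u i ≡ + 0
      vanish i Fᵢ rewrite Fᵢ = refl

    w-at : ∀ f → F f ≡ true → w f ≡ K f f * b f
    w-at f Ff = trans (sum-cong-≗ entry) (dot-δˡ f (λ j → K j f * b j))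
      where
      one : ∀ x → x ≡ + 1 * x
      one = solve-∀
      entry : ∀ j → (if F j then K j f else + 0) * b j ≡ δ f j * (K j f * b j)
      entry j with j ≟ f
      ... | yes refl rewrite Ff = trans (one (K f f * b f)) (cong (_* (K f f * b f)) (sym (δ-diag f)))
      ... | no  j≢f  = trans (trans (cong (_* b j) (zero-off j j≢f)) (*-zeroˡ (b j)))
              (sym (trans (cong (_* (K j f * b j)) (δ-off f j (j≢f ∘ sym))) (*-zeroˡ (K j f * b j))))
        where
        zero-off : ∀ j → j ≢ f → (if F j then K j f else + 0) ≡ + 0
        zero-off j j≢f with F j in Fⱼ
        ... | true  = proj₂ (proj₂ (dual j Fⱼ)) f Ff j≢f
        ... | false = refl

    b≡0 : ∀ i → b i ≡ + 0
    b≡0 i with F i in Fᵢ | u≡0 i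
    ... | false | bᵢ≡0 = bᵢ≡0
    ... | true  | _    = *-≢0-cancel (proj₁ (proj₂ (dual i Fᵢ))) (trans (sym (w-at i Fᵢ)) (w≡0 i))

  -- Otherwise every positive integer t would divide the nonzero number det (reduced 0).
  mult0≤countF : mult0 (charPoly A) ≤ countF F
  mult0≤countF with mult0 (charPoly A) ℕ.≤? countF F
  ... | yes m≤k = m≤k
  ... | no  m≰k = contradiction (all-divide⇒≡0 (detℤ n (reduced (+ 0))) divides)
                    (injective⇒detℤ≢0 n (reduced (+ 0)) reduced-injective)
    where
    k = countF F
    d = mult0 (charPoly A) ℕ.∸ suc k
    m≡ : mult0 (charPoly A) ≡ k ℕ.+ suc d
    m≡ = trans (sym (ℕₚ.m+[n∸m]≡n (ℕₚ.≰⇒> m≰k))) (sym (ℕₚ.+-suc k d))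
    divides : ∀ s → ∃ λ q → detℤ n (reduced (+ 0)) ≡ + suc s * q
    divides s = c * (t ^ d * q) + - e , (begin
      detℤ n (reduced (+ 0))
        ≡⟨ isolate (t * e) (detℤ n (reduced (+ 0))) ⟩
      t * e + detℤ n (reduced (+ 0)) + - (t * e)
        ≡⟨ cong (_+ - (t * e)) (trans (sym e-eq) cancelled) ⟩
      c * (t * t ^ d * q) + - (t * e)
        ≡⟨ collect c t (t ^ d) q e ⟩
      t * (c * (t ^ d * q) + - e) ∎)
      where
      t = + suc s
      e = proj₁ (reduced-mod t)
      e-eq = proj₂ (reduced-mod t)
      c = proj₁ (detℤ-· n basis)
      q = proj₁ (eval-mult0 t (charPoly A))
      isolate : ∀ x y → y ≡ x + y + - x
      isolate = solve-∀
      collect : ∀ c t p q e → c * (t * p * q) + - (t * e) ≡ t * (c * (p * q) + - e)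
      collect = solve-∀
      shuffle : ∀ c a b q → c * (a * b * q) ≡ a * (c * (b * q))
      shuffle = solve-∀
      instance
        t^k≢0 : ℤ.NonZero (t ^ k)
        t^k≢0 = ℤ.≢-nonZero (λ eq → contradiction (ℤₚ.i^n≡0⇒i≡0 t k eq) λ ())
      -- Two evaluations of the determinant of `charMatrix t · basis`: by columns it contains
      -- `t ^ k`, through the characteristic polynomial `t ^ (k + suc d)`. As `t` is positive,
      -- `t ^ k` cancels and at least one factor `t` survives.
      cancelled : detℤ n (reduced t) ≡ c * (t ^ suc d * q)
      cancelled = ℤₚ.*-cancelˡ-≡ (t ^ k) _ _ (begin
        t ^ k * detℤ n (reduced t)
          ≡⟨ cong (_* detℤ n (reduced t)) (product-indicator t F) ⟨
        product (λ j → if F j then t else + 1) * detℤ n (reduced t)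
          ≡⟨ detℤ-scale-columns n (λ j → if F j then t else + 1) (reduced t) ⟨
        detℤ n (λ i j → reduced t i j * (if F j then t else + 1))
          ≡⟨ detℤ-ext n (charMatrix-basis t) ⟨
        detℤ n (charMatrix t · basis)
          ≡⟨ proj₂ (detℤ-· n basis) (charMatrix t) ⟩
        c * detℤ n (charMatrix t)
          ≡⟨ cong (c *_) (eval-charPoly t A) ⟨
        c * eval t (charPoly A)
          ≡⟨ cong (c *_) (proj₂ (eval-mult0 t (charPoly A))) ⟩
        c * (t ^ mult0 (charPoly A) * q)
          ≡⟨ cong (λ m → c * (t ^ m * q)) m≡ ⟩
        c * (t ^ (k ℕ.+ suc d) * q)
          ≡⟨ cong (λ x → c * (x * q)) (ℤₚ.^-distribˡ-+-* t k (suc d)) ⟩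
        c * (t ^ k * t ^ suc d * q)
          ≡⟨ shuffle c (t ^ k) (t ^ suc d) q ⟩
        t ^ k * (c * (t ^ suc d * q)) ∎)

nullity-bound : ∀ {n} (A : Fin n → Row n) → Symmetric A →
  ∀ S → Determining A S → mult0 (charPoly A) ≤ countF S
nullity-bound {n} A A-sym S S-det =
  let F , F≤S , F-det , dual = minimal-determining A (countF S) S refl S-det
      total = λ j → choose F j (dual j)
  in ℕₚ.≤-trans (mult0≤countF A A-sym F F-det (λ j → proj₁ (total j)) (λ j → proj₂ (total j))) F≤S
  where
  -- The family `K` has to be total; outside `F`, where duality is not demanded, it is filled with
  -- the zero vector.
  choose : ∀ F j → (F j ≡ true → ∃ (IsDual A F j)) → Σ (Row n) λ K → F j ≡ true → IsDual A F j K
  choose F j dual with F j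
  ... | true  = proj₁ (dual refl) , λ _ → proj₂ (dual refl)
  ... | false = (λ _ → + 0) , λ ()

-- Graph search

∨-true : ∀ a {b} → a ∨ b ≡ true → a ≡ true ⊎ b ≡ true
∨-true true  _  = inj₁ refl
∨-true false eq = inj₂ eq

∨-introˡ : ∀ {a} b → a ≡ true → a ∨ b ≡ true
∨-introˡ b refl = refl

∨-introʳ : ∀ a {b} → b ≡ true → a ∨ b ≡ true
∨-introʳ a refl = Boolₚ.∨-zeroʳ a

∧-true : ∀ a {b} → a ∧ b ≡ true → a ≡ true × b ≡ true
∧-true true eq = refl , eq

∧-intro : ∀ {a b} → a ≡ true → b ≡ true → a ∧ b ≡ true
∧-intro refl refl = refl

≟-true : ∀ {n} {i j : Fin n} → ⌊ i ≟ j ⌋ ≡ true → i ≡ j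
≟-true {i = i} {j} eq with i ≟ j
... | yes i≡j = i≡j

≟-refl : ∀ {n} (i : Fin n) → ⌊ i ≟ i ⌋ ≡ true
≟-refl i with i ≟ i
... | yes _   = refl
... | no  i≢i = contradiction refl i≢i

anyF-true : ∀ {n} (P : Fin n → Bool) → anyF P ≡ true → ∃ λ i → P i ≡ true
anyF-true {suc n} P eq with ∨-true (P zero) eq
... | inj₁ P₀ = zero , P₀
... | inj₂ eq with anyF-true (P ∘ suc) eq
...   | i , Pᵢ = suc i , Pᵢ

anyF-false : ∀ {n} (P : Fin n → Bool) → (∀ i → P i ≡ false) → anyF P ≡ false
anyF-false {zero}  P eq = refl
anyF-false {suc n} P eq rewrite eq zero = anyF-false (P ∘ suc) (eq ∘ suc)

countF-mono : ∀ {n} {P Q : Fin n → Bool} → (∀ i → P i ≡ true → Q i ≡ true) → countF P ≤ countF Q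
countF-mono {zero}          P⊆Q = z≤n
countF-mono {suc n} {P} {Q} P⊆Q with P zero | Q zero | P⊆Q zero
... | false | false | _ = countF-mono (P⊆Q ∘ suc)
... | false | true  | _ = ℕₚ.m≤n⇒m≤1+n (countF-mono (P⊆Q ∘ suc))
... | true  | true  | _ = s≤s (countF-mono (P⊆Q ∘ suc))
... | true  | false | f = contradiction (f refl) λ ()

countF-∨ : ∀ {n} (P Q : Fin n → Bool) → countF (λ i → P i ∨ Q i) ≤ countF P ℕ.+ countF Q
countF-∨ {zero}  P Q = z≤n
countF-∨ {suc n} P Q with P zero | Q zero
... | false | false = countF-∨ (P ∘ suc) (Q ∘ suc)
... | false | true  = ℕₚ.≤-trans (s≤s (countF-∨ (P ∘ suc) (Q ∘ suc)))
                        (ℕₚ.≤-reflexive (sym (ℕₚ.+-suc (countF (P ∘ suc)) (countF (Q ∘ suc)))))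
... | true  | false = s≤s (countF-∨ (P ∘ suc) (Q ∘ suc))
... | true  | true  = s≤s (ℕₚ.≤-trans (countF-∨ (P ∘ suc) (Q ∘ suc))
                        (ℕₚ.+-monoʳ-≤ (countF (P ∘ suc)) (ℕₚ.n≤1+n (countF (Q ∘ suc)))))

countF-empty : ∀ {n} (P : Fin n → Bool) → (∀ i → P i ≡ false) → countF P ≡ 0
countF-empty {zero}  P eq = refl
countF-empty {suc n} P eq rewrite eq zero = countF-empty (P ∘ suc) (eq ∘ suc)

countF-positive : ∀ {n} (P : Fin n → Bool) → 1 ≤ countF P → ∃ λ i → P i ≡ true
countF-positive P 1≤ with any? (λ i → P i Boolₚ.≟ true)
... | yes found = found
... | no  none  = contradiction
  (subst (1 ≤_) (countF-empty P (λ i → Boolₚ.¬-not (λ Pᵢ → none (i , Pᵢ)))) 1≤) λ ()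

countF-single : ∀ {n} (i : Fin n) → countF (λ j → ⌊ i ≟ j ⌋) ≤ 1
countF-single i = ℕₚ.≤-trans (ℕₚ.≤-reflexive (countF-∖ (λ j → ⌊ i ≟ j ⌋) i (≟-refl i)))
  (s≤s (ℕₚ.≤-reflexive (countF-empty ((λ j → ⌊ i ≟ j ⌋) ∖ i) (λ j → Boolₚ.∧-inverseʳ ⌊ i ≟ j ⌋))))

countF-∖-< : ∀ {n} {P Q : Fin n → Bool} {i} → Q i ≡ true →
  (∀ j → P j ≡ true → (Q ∖ i) j ≡ true) → suc (countF P) ≤ countF Q
countF-∖-< {Q = Q} {i} Qᵢ P⊆Q∖i =
  ℕₚ.≤-trans (s≤s (countF-mono P⊆Q∖i)) (ℕₚ.≤-reflexive (sym (countF-∖ Q i Qᵢ)))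

least : ∀ {n} (P : Fin n → Bool) i → P i ≡ true →
  ∃ λ r → P r ≡ true × (∀ j → toℕ j ℕ.< toℕ r → P j ≡ false)
least {suc n} P i Pᵢ with P zero in P₀
... | true  = zero , P₀ , λ _ ()
... | false with i
...   | zero  = contradiction (trans (sym Pᵢ) P₀) λ ()
...   | suc i with least (P ∘ suc) i Pᵢ
...     | r , Pᵣ , below = suc r , Pᵣ , λ { zero _ → P₀ ; (suc j) (s≤s j<r) → below j j<r }

sumF-cong : ∀ {n} {f g : Fin n → ℕ} → (∀ i → f i ≡ g i) → sumF f ≡ sumF g
sumF-cong {zero}  eq = refl
sumF-cong {suc n} eq = cong₂ ℕ._+_ (eq zero) (sumF-cong (eq ∘ suc))

insert : ∀ {n} → Fin n → (Fin n → Bool) → Fin n → Bool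
insert q P j = P j ∨ ⌊ q ≟ j ⌋

insert-suc : ∀ {n} q (P : Fin (suc n) → Bool) j → insert (suc q) P (suc j) ≡ insert q (P ∘ suc) j
insert-suc q P j with q ≟ j
... | yes _ = refl
... | no  _ = refl

sumF-insert : ∀ {n} (e : Fin n → ℕ) P q → P q ≡ false →
  sumF (λ i → if insert q P i then e i else 0) ≡ e q ℕ.+ sumF (λ i → if P i then e i else 0)
sumF-insert e P zero Pq with P zero
... | false = cong (e zero ℕ.+_)
  (sumF-cong (λ i → cong (λ b → if b then e (suc i) else 0) (Boolₚ.∨-identityʳ (P (suc i)))))
sumF-insert e P (suc q) Pq with P zero
... | true  = trans
  (cong (e zero ℕ.+_) (trans
    (sumF-cong (λ i → cong (λ b → if b then e (suc i) else 0) (insert-suc q P i)))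
    (sumF-insert (e ∘ suc) (P ∘ suc) q Pq)))
  (x∙yz≈y∙xz ℕₚ.+-commutativeSemigroup (e zero) (e (suc q))
    (sumF (λ i → if P (suc i) then e (suc i) else 0)))
... | false = trans
  (sumF-cong (λ i → cong (λ b → if b then e (suc i) else 0) (insert-suc q P i)))
  (sumF-insert (e ∘ suc) (P ∘ suc) q Pq)

adjMatrix-symmetric : ∀ {n} (Γ : SignedGraph n) → Symmetric (adjMatrix Γ)
adjMatrix-symmetric Γ i j rewrite adj-sym Γ i j | sign-sym Γ i j = refl

adjMatrix-adjacent : ∀ {n} (Γ : SignedGraph n) {i j} → adj Γ i j ≡ true → adjMatrix Γ i j ≢ + 0
adjMatrix-adjacent Γ {i} {j} eq rewrite eq with sign Γ i j
... | true  = λ ()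
... | false = λ ()

-- In the kernel equation at `q` only the term at `y` survives, and its coefficient is a sign.
force : ∀ {n} (Γ : SignedGraph n) x {q y} → Kernel (adjMatrix Γ) x → adj Γ q y ≡ true →
  (∀ j → adj Γ q j ≡ true → y ≢ j → x j ≡ + 0) → x y ≡ + 0
force Γ x {q} {y} ker qy others = *-≢0-cancel (adjMatrix-adjacent Γ qy)
  (trans (sym (dot-δˡ y (λ j → adjMatrix Γ q j * x j))) (trans (sym (sum-cong-≗ entry)) (ker q)))
  where
  entry : ∀ j → adjMatrix Γ q j * x j ≡ δ y j * (adjMatrix Γ q j * x j)
  entry j with y ≟ j
  ... | yes refl = sym (trans (cong (_* (adjMatrix Γ q y * x y)) (δ-diag y)) (*-identityˡ (adjMatrix Γ q y * x y)))
  ... | no  y≢j  = trans zero-entry (sym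
    (trans (cong (_* (adjMatrix Γ q j * x j)) (δ-off y j y≢j)) (*-zeroˡ (adjMatrix Γ q j * x j))))
    where
    zero-entry : adjMatrix Γ q j * x j ≡ + 0
    zero-entry with adj Γ q j in qj
    ... | false = *-zeroˡ (x j)
    ... | true  = trans (cong ((if sign Γ q j then + 1 else - (+ 1)) *_) (others j qj y≢j))
                        (*-zeroʳ (if sign Γ q j then + 1 else - (+ 1)))

-- Truncated subtraction gives a pendant vertex 0 in place of -1; the number of pendant vertices
-- makes up the difference in `excess-sum`.
excess : ∀ {n} → SignedGraph n → Fin n → ℕ
excess Γ i = degree Γ i ∸ 2

-- b is the number of seeds charged to the starts of components; the others are
-- charged to processed vertices.
record Search {n} (Γ : SignedGraph n) (b : ℕ) : Set where
  field
    visited processed seeds : Fin n → Bool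
    forced    : ∀ x → Kernel (adjMatrix Γ) x → (∀ i → seeds i ≡ true → x i ≡ + 0) →
                ∀ i → visited i ≡ true → x i ≡ + 0
    companion : ∀ i → visited i ≡ true → ∃ λ j → adj Γ i j ≡ true × visited j ≡ true
    saturated : ∀ i j → processed i ≡ true → adj Γ i j ≡ true → visited j ≡ true
    bound     : countF seeds ≤ b ℕ.+ sumF (λ i → if processed i then excess Γ i else 0)

open Search

fresh : ∀ {n} {Γ : SignedGraph n} {b} → Search Γ b → Fin n → Fin n → Bool
fresh {Γ = Γ} s q j = adj Γ q j ∧ not (visited s j)

fresh-¬visited : ∀ {n} {Γ : SignedGraph n} {b} (s : Search Γ b) q {i j} →
  visited s i ≡ true → fresh s q j ≡ true → i ≢ j
fresh-¬visited {Γ = Γ} s q {i} vᵢ fⱼ refl with ∧-true (adj Γ q i) fⱼ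
... | _ , eq rewrite vᵢ = contradiction eq λ ()

fresh-one : ∀ {n} {Γ : SignedGraph n} {b} (s : Search Γ b) q {u} →
  adj Γ q u ≡ true → visited s u ≡ true → suc (countF (fresh s q)) ≤ degree Γ q
fresh-one {Γ = Γ} s q {u} qu vu = countF-∖-< qu
  (λ j fⱼ → ∖-other (adj Γ q) (fresh-¬visited s q vu fⱼ) (proj₁ (∧-true (adj Γ q j) fⱼ)))

fresh-two : ∀ {n} {Γ : SignedGraph n} {b} (s : Search Γ b) q {u v} → u ≢ v →
  adj Γ q u ≡ true → visited s u ≡ true → adj Γ q v ≡ true → visited s v ≡ true →
  suc (suc (countF (fresh s q))) ≤ degree Γ q
fresh-two {Γ = Γ} s q {u} {v} u≢v qu vu qv vv = ℕₚ.≤-trans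
  (s≤s (countF-∖-< {Q = adj Γ q ∖ u} (∖-other (adj Γ q) u≢v qv)
    (λ j fⱼ → ∖-other (adj Γ q ∖ u) (fresh-¬visited s q vv fⱼ)
                (∖-other (adj Γ q) (fresh-¬visited s q vu fⱼ) (proj₁ (∧-true (adj Γ q j) fⱼ))))))
  (ℕₚ.≤-reflexive (sym (countF-∖ (adj Γ q) u qu)))

-- Visiting all neighbours of q costs one seed for every fresh neighbour but
-- the last one, which is forced by the kernel equation at q.
process : ∀ {n} {Γ : SignedGraph n} {b} (s : Search Γ b) b′ q →
  visited s q ≡ true → processed s q ≡ false →
  b ℕ.+ (countF (fresh s q) ∸ 1) ≤ b′ ℕ.+ excess Γ q →
  Σ (Search Γ b′) λ s′ → (∀ i → visited s i ≡ true → visited s′ i ≡ true) ×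
    (∀ i → processed s′ i ≡ insert q (processed s) i)
process {n} {Γ} {b} s b′ q vq pq cost = record
  { visited   = λ j → visited s j ∨ adj Γ q j
  ; processed = insert q (processed s)
  ; seeds     = proj₁ seeding
  ; forced    = proj₂ (proj₂ seeding)
  ; companion = λ i vᵢ → [ (λ v → let j , ij , vⱼ = companion s i v in j , ij , ∨-introˡ _ vⱼ)
                         , (λ qi → q , trans (adj-sym Γ i q) qi , ∨-introˡ _ vq) ]′ (∨-true (visited s i) vᵢ)
  ; saturated = λ i j pᵢ ij → [ (λ p → ∨-introˡ _ (saturated s i j p ij))
                              , (λ q≡i → ∨-introʳ (visited s j) (subst (λ k → adj Γ k j ≡ true) (sym (≟-true q≡i)) ij)) ]′
                              (∨-true (processed s i) pᵢ)
  ; bound     = new-bound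
  } , (λ i vᵢ → ∨-introˡ _ vᵢ) , (λ i → refl)
  where
  P = sumF (λ i → if processed s i then excess Γ i else 0)

  Forces : (Fin n → Bool) → Set
  Forces S = ∀ x → Kernel (adjMatrix Γ) x → (∀ i → S i ≡ true → x i ≡ + 0) →
             ∀ i → visited s i ∨ adj Γ q i ≡ true → x i ≡ + 0

  seeding : Σ (Fin n → Bool) λ S → countF S ≤ countF (seeds s) ℕ.+ (countF (fresh s q) ∸ 1) × Forces S
  seeding with any? (λ y → fresh s q y Boolₚ.≟ true)
  ... | no none = seeds s , ℕₚ.m≤m+n (countF (seeds s)) _ , λ x ker vanish i vᵢ →
          forced s x ker vanish i ([ (λ v → v) , old i ]′ (∨-true (visited s i) vᵢ))
    where
    old : ∀ i → adj Γ q i ≡ true → visited s i ≡ true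
    old i qi with visited s i in vᵢ
    ... | true  = refl
    ... | false = contradiction (i , ∧-intro qi (cong not vᵢ)) none
  ... | yes (y , fy) = (λ i → seeds s i ∨ (fresh s q ∖ y) i) ,
          ℕₚ.≤-trans (countF-∨ (seeds s) (fresh s q ∖ y))
            (ℕₚ.+-monoʳ-≤ (countF (seeds s)) (ℕₚ.≤-reflexive (cong (_∸ 1) (sym (countF-∖ (fresh s q) y fy))))) ,
          λ x ker vanish i vᵢ → all x ker vanish i (∨-true (visited s i) vᵢ)
    where
    module _ (x : Row n) (ker : Kernel (adjMatrix Γ) x)
      (vanish : ∀ i → seeds s i ∨ (fresh s q ∖ y) i ≡ true → x i ≡ + 0) where
      old : ∀ i → visited s i ≡ true → x i ≡ + 0
      old = forced s x ker (λ i sᵢ → vanish i (∨-introˡ _ sᵢ))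
      others : ∀ j → adj Γ q j ≡ true → y ≢ j → x j ≡ + 0
      others j qj y≢j with visited s j in vⱼ
      ... | true  = old j vⱼ
      ... | false = vanish j (∨-introʳ (seeds s j) (∖-other (fresh s q) y≢j (∧-intro qj (cong not vⱼ))))
      all : ∀ i → visited s i ≡ true ⊎ adj Γ q i ≡ true → x i ≡ + 0
      all i (inj₁ vᵢ) = old i vᵢ
      all i (inj₂ qi) with y ≟ i
      ... | no  y≢i  = others i qi y≢i
      ... | yes refl = force Γ x ker qi others

  new-bound : countF (proj₁ seeding) ≤ b′ ℕ.+ sumF (λ i → if insert q (processed s) i then excess Γ i else 0)
  new-bound = ℕₚ.≤-trans (proj₁ (proj₂ seeding)) (ℕₚ.≤-trans
    (ℕₚ.+-monoˡ-≤ (countF (fresh s q) ∸ 1) (bound s)) (ℕₚ.≤-trans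
    (ℕₚ.≤-reflexive (xy∙z≈xz∙y ℕₚ.+-commutativeSemigroup b P (countF (fresh s q) ∸ 1))) (ℕₚ.≤-trans
    (ℕₚ.+-monoˡ-≤ P cost) (ℕₚ.≤-reflexive
    (trans (ℕₚ.+-assoc b′ (excess Γ q) P)
           (cong (b′ ℕ.+_) (sym (sumF-insert (excess Γ) (processed s) q pq))))))))

-- `U` is the set of vertices that may be processed: all of them when a component is to be
-- exhausted, all but one when that vertex is to be postponed. The number `k` bounds the unprocessed
-- vertices and drives the recursion.
close : ∀ {n} {Γ : SignedGraph n} {b} (U : Fin n → Bool) k (s : Search Γ b) →
  countF (λ i → not (processed s i)) ≤ k →
  Σ (Search Γ b) λ s′ → (∀ i → visited s i ≡ true → visited s′ i ≡ true) ×
    (∀ i → visited s′ i ≡ true → U i ≡ true → processed s′ i ≡ true) ×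
    (∀ i → U i ≡ false → processed s′ i ≡ processed s i)
close {n} {Γ} {b} U k s left with any? (λ q → (visited s q ∧ (U q ∧ not (processed s q))) Boolₚ.≟ true)
... | no  done = s , (λ _ v → v) , all , (λ _ _ → refl)
  where
  all : ∀ i → visited s i ≡ true → U i ≡ true → processed s i ≡ true
  all i vᵢ Uᵢ with processed s i in pᵢ
  ... | true  = refl
  ... | false = contradiction (i , ∧-intro vᵢ (∧-intro Uᵢ (cong not pᵢ))) done
... | yes (q , eq) = continue k left
  where
  vq : visited s q ≡ true
  vq = proj₁ (∧-true (visited s q) eq)
  Uq : U q ≡ true
  Uq = proj₁ (∧-true (U q) (proj₂ (∧-true (visited s q) eq)))
  nq : not (processed s q) ≡ true
  nq = proj₂ (∧-true (U q) (proj₂ (∧-true (visited s q) eq)))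
  pq : processed s q ≡ false
  pq = trans (sym (Boolₚ.not-involutive (processed s q))) (cong not nq)
  cost : b ℕ.+ (countF (fresh s q) ∸ 1) ≤ b ℕ.+ excess Γ q
  cost = let u , qu , vu = companion s q vq
         in ℕₚ.+-monoʳ-≤ b (ℕₚ.∸-monoˡ-≤ 2 (fresh-one s q qu vu))
  step = process s b q vq pq cost
  s₁ = proj₁ step
  less : ∀ {k} → countF (λ i → not (processed s i)) ≤ suc k → countF (λ i → not (processed s₁ i)) ≤ k
  less le = ℕₚ.≤-pred (ℕₚ.≤-trans (countF-∖-< {i = q} nq remaining) le)
    where
    remaining : ∀ j → not (processed s₁ j) ≡ true → ((λ i → not (processed s i)) ∖ q) j ≡ true
    remaining j eq rewrite proj₂ (proj₂ step) j with processed s j | ⌊ q ≟ j ⌋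
    ... | false | false = refl
  continue : ∀ k → countF (λ i → not (processed s i)) ≤ k → _
  continue zero left = contradiction (ℕₚ.≤-trans (ℕₚ.≤-reflexive (sym (countF-∖ _ q nq))) left) λ ()
  continue (suc k) left with close U k s₁ (less left)
  ... | s₂ , visited⊆ , processed-U , unprocessed = s₂ , (λ i vᵢ → visited⊆ i (proj₁ (proj₂ step) i vᵢ)) , processed-U ,
    λ i Uᵢ → trans (unprocessed i Uᵢ) (trans (proj₂ (proj₂ step) i) (same i Uᵢ))
    where
    same : ∀ i → U i ≡ false → insert q (processed s) i ≡ processed s i
    same i Uᵢ with q ≟ i
    ... | yes refl = contradiction (trans (sym Uq) Uᵢ) λ ()
    ... | no  _    = Boolₚ.∨-identityʳ (processed s i)

empty : ∀ {n} (Γ : SignedGraph n) → Search Γ 0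
empty {n} Γ = record
  { visited   = λ _ → false
  ; processed = λ _ → false
  ; seeds     = λ _ → false
  ; forced    = λ _ _ _ _ ()
  ; companion = λ _ ()
  ; saturated = λ _ _ ()
  ; bound     = ℕₚ.≤-trans (ℕₚ.≤-reflexive (countF-empty {n} (λ _ → false) (λ _ → refl))) z≤n
  }

-- An edge rather than a vertex is seeded so that each end has the other as its `companion`.
start : ∀ {n} {Γ : SignedGraph n} {b} (s : Search Γ b) z y → adj Γ z y ≡ true →
  Σ (Search Γ (2 ℕ.+ b)) λ s′ → (∀ i → visited s i ≡ true → visited s′ i ≡ true) ×
    visited s′ z ≡ true × visited s′ y ≡ true × (∀ i → processed s′ i ≡ processed s i)
start {n} {Γ} {b} s z y zy = record
  { visited   = λ i → visited s i ∨ edge i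
  ; processed = processed s
  ; seeds     = λ i → seeds s i ∨ edge i
  ; forced    = λ x ker vanish i vᵢ →
      [ forced s x ker (λ j sⱼ → vanish j (∨-introˡ _ sⱼ)) i
      , (λ e → vanish i (∨-introʳ (seeds s i) e)) ]′ (∨-true (visited s i) vᵢ)
  ; companion = λ i vᵢ → [ (λ v → let j , ij , vⱼ = companion s i v in j , ij , ∨-introˡ _ vⱼ)
                         , (λ e → [ (λ z≡i → y , subst (λ k → adj Γ k y ≡ true) (≟-true z≡i) zy , y-new)
                                  , (λ y≡i → z , subst (λ k → adj Γ k z ≡ true) (≟-true y≡i) (trans (adj-sym Γ y z) zy) , z-new)
                                  ]′ (∨-true ⌊ z ≟ i ⌋ e)) ]′ (∨-true (visited s i) vᵢ)
  ; saturated = λ i j pᵢ ij → ∨-introˡ _ (saturated s i j pᵢ ij)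
  ; bound     = ℕₚ.≤-trans (countF-∨ (seeds s) edge) (ℕₚ.≤-trans
      (ℕₚ.+-mono-≤ (bound s) edge-count) (ℕₚ.≤-reflexive (ℕₚ.+-comm (b ℕ.+ P) 2)))
  } , (λ i vᵢ → ∨-introˡ _ vᵢ) , z-new , y-new , (λ _ → refl)
  where
  P = sumF (λ i → if processed s i then excess Γ i else 0)
  edge : Fin n → Bool
  edge i = ⌊ z ≟ i ⌋ ∨ ⌊ y ≟ i ⌋
  z-new : visited s z ∨ edge z ≡ true
  z-new = ∨-introʳ (visited s z) (∨-introˡ _ (≟-refl z))
  y-new : visited s y ∨ edge y ≡ true
  y-new = ∨-introʳ (visited s y) (∨-introʳ ⌊ z ≟ y ⌋ (≟-refl y))
  edge-count : countF edge ≤ 2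
  edge-count = ℕₚ.≤-trans (countF-∨ (λ i → ⌊ z ≟ i ⌋) (λ i → ⌊ y ≟ i ⌋))
                 (ℕₚ.+-mono-≤ (countF-single z) (countF-single y))

start-pendant : ∀ {n} {Γ : SignedGraph n} z y → adj Γ z y ≡ true → degree Γ z ≡ 1 →
  Σ (Search Γ 1) λ s → visited s z ≡ true
start-pendant {n} {Γ} z y zy deg = record
  { visited   = λ i → ⌊ z ≟ i ⌋ ∨ ⌊ y ≟ i ⌋
  ; processed = λ _ → false
  ; seeds     = λ i → ⌊ z ≟ i ⌋
  ; forced    = λ x ker vanish i vᵢ → [ vanish i
                  , (λ y≡i → subst (λ k → x k ≡ + 0) (≟-true y≡i)
                       (force Γ x ker zy (λ j zj y≢j → contradiction zj (only j y≢j)))) ]′ (∨-true ⌊ z ≟ i ⌋ vᵢ)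
  ; companion = λ i vᵢ → [ (λ z≡i → y , subst (λ k → adj Γ k y ≡ true) (≟-true z≡i) zy , ∨-introʳ ⌊ z ≟ y ⌋ (≟-refl y))
                         , (λ y≡i → z , subst (λ k → adj Γ k z ≡ true) (≟-true y≡i) (trans (adj-sym Γ y z) zy) , ∨-introˡ _ (≟-refl z))
                         ]′ (∨-true ⌊ z ≟ i ⌋ vᵢ)
  ; saturated = λ _ _ ()
  ; bound     = ℕₚ.≤-trans (countF-single z) (s≤s z≤n)
  } , ∨-introˡ _ (≟-refl z)
  where
  only : ∀ j → y ≢ j → adj Γ z j ≢ true
  only j y≢j zj = contradiction (ℕₚ.≤-trans
    (s≤s (countF-∖-< {P = λ _ → false} {i = j} (∖-other (adj Γ z) y≢j zj) (λ _ ())))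
    (ℕₚ.≤-reflexive (trans (sym (countF-∖ (adj Γ z) y zy)) deg))) λ { (s≤s ()) }

-- Unions of components, counted by their least vertices

Closed : ∀ {n} → SignedGraph n → (Fin n → Bool) → Set
Closed Γ V = ∀ i j → adj Γ i j ≡ true → V i ≡ true → V j ≡ true

closed-reach : ∀ {n} {Γ : SignedGraph n} {V} → Closed Γ V →
  ∀ k i j → reach Γ k i j ≡ true → V i ≡ true → V j ≡ true
closed-reach closed zero i j eq Vᵢ with refl ← ≟-true {i = i} {j} eq = Vᵢ
closed-reach {Γ = Γ} closed (suc k) i j eq Vᵢ with ∨-true (reach Γ k i j) eq
... | inj₁ r = closed-reach closed k i j r Vᵢ
... | inj₂ e with anyF-true (λ l → reach Γ k i l ∧ adj Γ l j) e
...   | l , rl = let r , lj = ∧-true (reach Γ k i l) rl in closed l j lj (closed-reach closed k i l r Vᵢ)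

closed-reach⁻¹ : ∀ {n} {Γ : SignedGraph n} {V} → Closed Γ V →
  ∀ k i j → reach Γ k i j ≡ true → V j ≡ true → V i ≡ true
closed-reach⁻¹ closed zero i j eq Vⱼ with refl ← ≟-true {i = i} {j} eq = Vⱼ
closed-reach⁻¹ {Γ = Γ} closed (suc k) i j eq Vⱼ with ∨-true (reach Γ k i j) eq
... | inj₁ r = closed-reach⁻¹ closed k i j r Vⱼ
... | inj₂ e with anyF-true (λ l → reach Γ k i l ∧ adj Γ l j) e
...   | l , rl = let r , lj = ∧-true (reach Γ k i l) rl
                 in closed-reach⁻¹ closed k i l r (closed j l (trans (adj-sym Γ j l) lj) Vⱼ)

has-neighbour : ∀ {n} {Γ : SignedGraph n} → ComponentsNontrivial Γ → ∀ v → ∃ λ u → adj Γ v u ≡ true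
has-neighbour {n} {Γ} nontrivial v = let u , u≢v , c = nontrivial v in last-step n u u≢v c
  where
  last-step : ∀ k u → u ≢ v → reach Γ k u v ≡ true → ∃ λ u → adj Γ v u ≡ true
  last-step zero    u u≢v eq = contradiction (≟-true eq) u≢v
  last-step (suc k) u u≢v eq with ∨-true (reach Γ k u v) eq
  ... | inj₁ r = last-step k u u≢v r
  ... | inj₂ e = let l , rl = anyF-true (λ l → reach Γ k u l ∧ adj Γ l v) e
                 in l , trans (adj-sym Γ v l) (proj₂ (∧-true (reach Γ k u l) rl))

-- The predicate counted by `ω`, named so that it can be restricted to a closed set.
isRoot : ∀ {n} → SignedGraph n → Fin n → Bool
isRoot Γ i = not (anyF (λ j → (toℕ j <ᵇ toℕ i) ∧ connectedᵇ Γ j i))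

-- The least vertex of V′ outside V is the least vertex of its component.
roots-grow : ∀ {n} (Γ : SignedGraph n) {V V′} → Closed Γ V → Closed Γ V′ →
  (∀ i → V i ≡ true → V′ i ≡ true) → ∀ z → V′ z ≡ true → V z ≡ false →
  suc (countF (λ i → isRoot Γ i ∧ V i)) ≤ countF (λ i → isRoot Γ i ∧ V′ i)
roots-grow {n} Γ {V} {V′} closed closed′ V⊆V′ z V′z Vz
  with least (λ i → V′ i ∧ not (V i)) z (∧-intro V′z (cong not Vz))
... | r , new , below = countF-∖-< {Q = λ i → isRoot Γ i ∧ V′ i} {i = r} (∧-intro root V′r)
        (λ j eq → let rⱼ , Vⱼ = ∧-true (isRoot Γ j) eq
                  in ∖-other (λ i → isRoot Γ i ∧ V′ i)
                       (λ { refl → contradiction (trans (sym Vⱼ) Vr) λ () }) (∧-intro rⱼ (V⊆V′ j Vⱼ)))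
  where
  V′r : V′ r ≡ true
  V′r = proj₁ (∧-true (V′ r) new)
  Vr : V r ≡ false
  Vr = trans (sym (Boolₚ.not-involutive (V r))) (cong not (proj₂ (∧-true (V′ r) new)))
  separated : ∀ j → toℕ j ℕ.< toℕ r → connectedᵇ Γ j r ≡ false
  separated j j<r = Boolₚ.¬-not λ c → contradiction
    (trans (sym (∧-intro (closed-reach⁻¹ closed′ n j r c V′r)
      (cong not (Boolₚ.¬-not λ Vⱼ → contradiction (trans (sym (closed-reach closed n j r c Vⱼ)) Vr) λ ()))))
      (below j j<r)) λ ()
  root : isRoot Γ r ≡ true
  root = cong not (anyF-false (λ j → (toℕ j <ᵇ toℕ r) ∧ connectedᵇ Γ j r) λ j → not-both j)
    where
    not-both : ∀ j → (toℕ j <ᵇ toℕ r) ∧ connectedᵇ Γ j r ≡ false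
    not-both j with toℕ j <ᵇ toℕ r in lt
    ... | false = refl
    ... | true  = separated j (ℕₚ.<ᵇ⇒< (toℕ j) (toℕ r) (subst IsTrue (sym lt) _))

Complete : ∀ {n} {Γ : SignedGraph n} {b} → Search Γ b → Set
Complete s = ∀ i → visited s i ≡ true → processed s i ≡ true

complete⇒closed : ∀ {n} {Γ : SignedGraph n} {b} (s : Search Γ b) → Complete s → Closed Γ (visited s)
complete⇒closed s complete i j ij vᵢ = saturated s i j (complete i vᵢ) ij

close-all : ∀ {n} {Γ : SignedGraph n} {b} (s : Search Γ b) →
  Σ (Search Γ b) λ s′ → (∀ i → visited s i ≡ true → visited s′ i ≡ true) × Complete s′
close-all s with close (λ _ → true) _ s ℕₚ.≤-refl
... | s′ , visited⊆ , complete , _ = s′ , visited⊆ , λ i vᵢ → complete i vᵢ refl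

-- The budget of two seeds for each root reached, with `ε` of them still unspent.
Within : ∀ {n} (Γ : SignedGraph n) (ε b : ℕ) → (Fin n → Bool) → Set
Within Γ ε b V = b ℕ.+ ε ≤ 2 ℕ.* countF (λ i → isRoot Γ i ∧ V i)

-- Starting at an unvisited vertex costs two seeds, and exhausting its component reaches a new root,
-- which pays for both; a saving `ε` made earlier therefore persists.
search-all : ∀ {n} {Γ : SignedGraph n} → ComponentsNontrivial Γ → ∀ ε k {b} (s : Search Γ b) →
  countF (λ i → not (visited s i)) ≤ k → Complete s → Within Γ ε b (visited s) →
  ∃ λ b′ → Σ (Search Γ b′) λ s′ → (∀ i → visited s′ i ≡ true) × b′ ℕ.+ ε ≤ 2 ℕ.* ω Γ
search-all {n} {Γ} nontrivial ε k {b} s left complete within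
  with any? (λ z → visited s z Boolₚ.≟ false)
... | no none = b , s , (λ i → Boolₚ.¬-not (λ vᵢ → none (i , vᵢ))) ,
        ℕₚ.≤-trans within (ℕₚ.*-monoʳ-≤ 2 (countF-mono (λ i eq → proj₁ (∧-true (isRoot Γ i) eq))))
... | yes (z , vz) = continue k left
  where
  y = proj₁ (has-neighbour nontrivial z)
  started = start s z y (proj₂ (has-neighbour nontrivial z))
  closed-up = close-all (proj₁ started)
  s′ = proj₁ closed-up
  visited⊆ : ∀ i → visited s i ≡ true → visited s′ i ≡ true
  visited⊆ i vᵢ = proj₁ (proj₂ closed-up) i (proj₁ (proj₂ started) i vᵢ)
  z-visited : visited s′ z ≡ true
  z-visited = proj₁ (proj₂ closed-up) z (proj₁ (proj₂ (proj₂ started)))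
  complete′ : Complete s′
  complete′ = proj₂ (proj₂ closed-up)
  grown : suc (countF (λ i → isRoot Γ i ∧ visited s i)) ≤ countF (λ i → isRoot Γ i ∧ visited s′ i)
  grown = roots-grow Γ (complete⇒closed s complete) (complete⇒closed s′ complete′) visited⊆ z z-visited vz
  within′ : Within Γ ε (2 ℕ.+ b) (visited s′)
  within′ = ℕₚ.≤-trans (ℕₚ.+-monoʳ-≤ 2 within) (ℕₚ.≤-trans
    (ℕₚ.≤-reflexive (sym (ℕₚ.*-suc 2 (countF (λ i → isRoot Γ i ∧ visited s i)))))
    (ℕₚ.*-monoʳ-≤ 2 grown))
  continue : ∀ k → countF (λ i → not (visited s i)) ≤ k → _
  continue zero left = contradiction (ℕₚ.≤-trans
    (ℕₚ.≤-reflexive (sym (countF-∖ (λ i → not (visited s i)) z (cong not vz)))) left) λ ()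
  continue (suc k) left = search-all nontrivial ε k s′ (ℕₚ.≤-pred (ℕₚ.≤-trans
    (countF-∖-< {Q = λ i → not (visited s i)} {i = z} (cong not vz) unvisited) left)) complete′ within′
    where
    unvisited : ∀ j → not (visited s′ j) ≡ true → ((λ i → not (visited s i)) ∖ z) j ≡ true
    unvisited j nⱼ = ∖-other (λ i → not (visited s i))
      (λ { refl → contradiction (trans (sym nⱼ) (cong not z-visited)) λ () })
      (cong not (Boolₚ.¬-not λ vⱼ → contradiction (trans (sym nⱼ) (cong not (visited⊆ j vⱼ))) λ ()))

search-bound : ∀ {n} {Γ : SignedGraph n} → ComponentsNontrivial Γ → ∀ ε {b} (s : Search Γ b) →
  Complete s → Within Γ ε b (visited s) → η Γ ℕ.+ ε ≤ 2 ℕ.* ω Γ ℕ.+ sumF (excess Γ)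
search-bound {Γ = Γ} nontrivial ε s complete within
  with search-all nontrivial ε _ s ℕₚ.≤-refl complete within
... | b , s′ , all , b+ε≤ = ℕₚ.≤-trans
    (ℕₚ.+-monoˡ-≤ ε (ℕₚ.≤-trans nullity (ℕₚ.≤-trans (bound s′) (ℕₚ.+-monoʳ-≤ b (sumF-mono restrict)))))
    (ℕₚ.≤-trans (ℕₚ.≤-reflexive (xy∙z≈xz∙y ℕₚ.+-commutativeSemigroup b (sumF (excess Γ)) ε))
                (ℕₚ.+-monoˡ-≤ (sumF (excess Γ)) b+ε≤))
  where
  nullity : η Γ ≤ countF (seeds s′)
  nullity = nullity-bound (adjMatrix Γ) (adjMatrix-symmetric Γ) (seeds s′)
    (λ x ker vanish i → forced s′ x ker vanish i (all i))
  sumF-mono : ∀ {n} {f g : Fin n → ℕ} → (∀ i → f i ≤ g i) → sumF f ≤ sumF g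
  sumF-mono {zero}  le = z≤n
  sumF-mono {suc n} le = ℕₚ.+-mono-≤ (le zero) (sumF-mono (le ∘ suc))
  restrict : ∀ i → (if processed s′ i then excess Γ i else 0) ≤ excess Γ i
  restrict i with processed s′ i
  ... | true  = ℕₚ.≤-refl
  ... | false = z≤n

-- One charged seed against a budget of two leaves 1 over as soon as a root has been reached;
-- `roots-grow`, applied from the empty closed set, provides the root.
search-bound-saving : ∀ {n} {Γ : SignedGraph n} → ComponentsNontrivial Γ → (s : Search Γ 1) →
  ∀ z → visited s z ≡ true → η Γ ℕ.+ 1 ≤ 2 ℕ.* ω Γ ℕ.+ sumF (excess Γ)
search-bound-saving {n} {Γ} nontrivial s z vz with close-all s
... | s′ , visited⊆ , complete = search-bound nontrivial 1 s′ complete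
        (ℕₚ.*-monoʳ-≤ 2 (ℕₚ.≤-trans (s≤s z≤n)
          (roots-grow Γ {V = λ _ → false} (λ _ _ _ ()) (complete⇒closed s′ complete) (λ _ ()) z (visited⊆ z vz) refl)))

-- Vertex degrees and the cyclomatic number

indicator : Bool → ℕ
indicator b = if b then 1 else 0

countF≡sumF : ∀ {n} (P : Fin n → Bool) → countF P ≡ sumF (λ i → indicator (P i))
countF≡sumF {zero}  P = refl
countF≡sumF {suc n} P = cong (indicator (P zero) ℕ.+_) (countF≡sumF (P ∘ suc))

sumF-+ : ∀ {n} (f g : Fin n → ℕ) → sumF (λ i → f i ℕ.+ g i) ≡ sumF f ℕ.+ sumF g
sumF-+ {zero}  f g = refl
sumF-+ {suc n} f g = trans (cong (f zero ℕ.+ g zero ℕ.+_) (sumF-+ (f ∘ suc) (g ∘ suc)))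
  (interchange ℕₚ.+-commutativeSemigroup (f zero) (g zero) (sumF (f ∘ suc)) (sumF (g ∘ suc)))

sumF-const : ∀ n c → sumF {n} (λ _ → c) ≡ n ℕ.* c
sumF-const zero    c = refl
sumF-const (suc n) c = cong (c ℕ.+_) (sumF-const n c)

sumF-comm : ∀ {m n} (f : Fin m → Fin n → ℕ) →
  sumF (λ i → sumF (f i)) ≡ sumF (λ j → sumF (λ i → f i j))
sumF-comm {zero}  {n} f = sym (trans (sumF-const n 0) (ℕₚ.*-zeroʳ n))
sumF-comm {suc m} {n} f = trans (cong (sumF (f zero) ℕ.+_) (sumF-comm (f ∘ suc)))
  (sym (sumF-+ (f zero) (λ j → sumF (λ i → f (suc i) j))))

-- `numEdges` counts each edge at its smaller end; the transposed sum counts it at its larger end.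
handshake : ∀ {n} (Γ : SignedGraph n) → sumF (degree Γ) ≡ numEdges Γ ℕ.+ numEdges Γ
handshake Γ = begin
  sumF (degree Γ)
    ≡⟨ sumF-cong (λ i → countF≡sumF (adj Γ i)) ⟩
  sumF (λ i → sumF (λ j → indicator (adj Γ i j)))
    ≡⟨ sumF-cong (λ i → sumF-cong (split i)) ⟩
  sumF (λ i → sumF (λ j → up i j ℕ.+ up j i))
    ≡⟨ sumF-cong (λ i → sumF-+ (up i) (λ j → up j i)) ⟩
  sumF (λ i → sumF (up i) ℕ.+ sumF (λ j → up j i))
    ≡⟨ sumF-+ (λ i → sumF (up i)) (λ i → sumF (λ j → up j i)) ⟩
  sumF (λ i → sumF (up i)) ℕ.+ sumF (λ i → sumF (λ j → up j i))
    ≡⟨ cong (sumF (λ i → sumF (up i)) ℕ.+_) (sumF-comm up) ⟨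
  sumF (λ i → sumF (up i)) ℕ.+ sumF (λ i → sumF (up i))
    ≡⟨ cong (λ m → m ℕ.+ m) (sumF-cong (λ i → countF≡sumF (λ j → (toℕ i <ᵇ toℕ j) ∧ adj Γ i j))) ⟨
  numEdges Γ ℕ.+ numEdges Γ ∎
  where
  up : _ → _ → ℕ
  up i j = indicator ((toℕ i <ᵇ toℕ j) ∧ adj Γ i j)
  <ᵇ-true : ∀ {i j} → (i <ᵇ j) ≡ true → i ℕ.< j
  <ᵇ-true {i} {j} eq = ℕₚ.<ᵇ⇒< i j (subst IsTrue (sym eq) _)
  <ᵇ-false : ∀ {i j} → (i <ᵇ j) ≡ false → j ≤ i
  <ᵇ-false eq = ℕₚ.≮⇒≥ (λ i<j → subst IsTrue eq (ℕₚ.<⇒<ᵇ i<j))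
  split : ∀ i j → indicator (adj Γ i j) ≡ up i j ℕ.+ up j i
  split i j rewrite adj-sym Γ j i with toℕ i <ᵇ toℕ j in ij | toℕ j <ᵇ toℕ i in ji
  ... | true  | true  = contradiction (<ᵇ-true {toℕ i} ij) (ℕₚ.<-asym (<ᵇ-true {toℕ j} ji))
  ... | true  | false = sym (ℕₚ.+-identityʳ (indicator (adj Γ i j)))
  ... | false | true  = refl
  ... | false | false
    with refl ← toℕ-injective {i = i} {j} (ℕₚ.≤-antisym (<ᵇ-false ji) (<ᵇ-false ij)) = cong indicator (adj-irrefl Γ i)

-- For a degree `d` of at least 1, `d ∸ 2 + 2` exceeds `d` exactly at `d = 1`, and then by 1.
-- Nontrivial components exclude `d = 0`.
excess-sum : ∀ {n} (Γ : SignedGraph n) → ComponentsNontrivial Γ →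
  sumF (excess Γ) ℕ.+ n ℕ.* 2 ≡ numEdges Γ ℕ.+ numEdges Γ ℕ.+ pendants Γ
excess-sum {n} Γ nontrivial = begin
  sumF (excess Γ) ℕ.+ n ℕ.* 2
    ≡⟨ cong (sumF (excess Γ) ℕ.+_) (sumF-const n 2) ⟨
  sumF (excess Γ) ℕ.+ sumF {n} (λ _ → 2)
    ≡⟨ sumF-+ (excess Γ) (λ _ → 2) ⟨
  sumF (λ i → excess Γ i ℕ.+ 2)
    ≡⟨ sumF-cong (λ i → pointwise (degree Γ i) (positive i)) ⟩
  sumF (λ i → degree Γ i ℕ.+ indicator (degree Γ i ≡ᵇ 1))
    ≡⟨ sumF-+ (degree Γ) (λ i → indicator (degree Γ i ≡ᵇ 1)) ⟩
  sumF (degree Γ) ℕ.+ sumF (λ i → indicator (degree Γ i ≡ᵇ 1))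
    ≡⟨ cong₂ ℕ._+_ (handshake Γ) (sym (countF≡sumF (λ i → degree Γ i ≡ᵇ 1))) ⟩
  numEdges Γ ℕ.+ numEdges Γ ℕ.+ pendants Γ ∎
  where
  positive : ∀ i → 1 ≤ degree Γ i
  positive i = let u , iu = has-neighbour nontrivial i
               in ℕₚ.≤-trans (s≤s z≤n) (ℕₚ.≤-reflexive (sym (countF-∖ (adj Γ i) u iu)))
  pointwise : ∀ d → 1 ≤ d → d ∸ 2 ℕ.+ 2 ≡ d ℕ.+ indicator (d ≡ᵇ 1)
  pointwise (suc zero)    _ = refl
  pointwise (suc (suc d)) _ = trans (ℕₚ.+-comm d 2) (sym (ℕₚ.+-identityʳ (2 ℕ.+ d)))

cyclomatic-excess : ∀ {n} (Γ : SignedGraph n) → ComponentsNontrivial Γ →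
  + 2 * cyclomatic Γ + + pendants Γ ≡ + (2 ℕ.* ω Γ ℕ.+ sumF (excess Γ))
cyclomatic-excess {n} Γ nontrivial = begin
  + 2 * ((+ m ℤ.- + n) + + ω Γ) + + p
    ≡⟨ collect (+ m) (+ n) (+ ω Γ) (+ p) ⟩
  (+ m + + m + + p) + (+ 2 * + ω Γ + - (+ n * + 2))
    ≡⟨ cong (_+ (+ 2 * + ω Γ + - (+ n * + 2))) total ⟨
  (+ E + + n * + 2) + (+ 2 * + ω Γ + - (+ n * + 2))
    ≡⟨ cancel (+ E) (+ n * + 2) (+ 2 * + ω Γ) ⟩
  + 2 * + ω Γ + + E
    ≡⟨ cong (_+ + E) (ℤₚ.pos-* 2 (ω Γ)) ⟨
  + (2 ℕ.* ω Γ ℕ.+ E) ∎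
  where
  m = numEdges Γ
  p = pendants Γ
  E = sumF (excess Γ)
  collect : ∀ m n w p → + 2 * ((m + - n) + w) + p ≡ (m + m + p) + (+ 2 * w + - (n * + 2))
  collect = solve-∀
  cancel : ∀ e x y → (e + x) + (y + - x) ≡ y + e
  cancel = solve-∀
  total : + E + + n * + 2 ≡ + m + + m + + p
  total = trans (cong (λ x → + E + x) (sym (ℤₚ.pos-* n 2))) (cong +_ (excess-sum Γ nontrivial))

-- Cycles

consecPairs-∷ʳ : ∀ {A : Set} {P : A × A → Set} xs x y → All P (consecPairs (xs ++ [ x ])) → P (x , y) →
  All P (consecPairs ((xs ++ [ x ]) ++ [ y ]))
consecPairs-∷ʳ []           x y ps       p = p ∷ []
consecPairs-∷ʳ (_ ∷ [])     x y (q ∷ qs) p = q ∷ p ∷ []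
consecPairs-∷ʳ (_ ∷ z ∷ xs) x y (q ∷ qs) p = q ∷ consecPairs-∷ʳ (z ∷ xs) x y qs p

-- A cycle is stored from some starting vertex; rotation allows any of its vertices to come first
-- without reversing an edge or adding one.
closedPairs-rotate : ∀ {A : Set} {P : A × A → Set} (xs ys : List A) →
  All P (closedPairs (xs ++ ys)) → All P (closedPairs (ys ++ xs))
closedPairs-rotate {P = P} [] ys ps = subst (λ l → All P (closedPairs l)) (sym (++-identityʳ ys)) ps
closedPairs-rotate {P = P} (x ∷ xs) ys ps =
  subst (λ l → All P (closedPairs l)) (++-assoc ys [ x ] xs)
    (closedPairs-rotate xs (ys ++ [ x ])
      (subst (λ l → All P (closedPairs l)) (++-assoc xs ys [ x ]) (rotate₁ (xs ++ ys) ps)))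
  where
  rotate₁ : ∀ zs → All P (closedPairs (x ∷ zs)) → All P (closedPairs (zs ++ [ x ]))
  rotate₁ []       ps       = ps
  rotate₁ (y ∷ zs) (p ∷ ps) = consecPairs-∷ʳ (y ∷ zs) x y ps p

-- Finds the predecessor of `y` on a cycle written from `y`, that is, the vertex from which the
-- closing pair returns.
last-pair : ∀ {A : Set} {P : A × A → Set} x xs y → All P (consecPairs ((x ∷ xs) ++ [ y ])) →
  ∃ λ z → z ∈ x ∷ xs × P (z , y)
last-pair x []       y (p ∷ _)  = x , here refl , p
last-pair x (_ ∷ xs) y (_ ∷ ps) = let z , z∈ , p = last-pair _ xs y ps in z , there z∈ , p

∈-consecPairs : ∀ {A : Set} (xs : List A) {a b} → (a , b) ∈ consecPairs xs → a ∈ xs × b ∈ xs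
∈-consecPairs (x ∷ y ∷ xs) (here refl) = here refl , there (here refl)
∈-consecPairs (x ∷ y ∷ xs) (there ab)  = let a , b = ∈-consecPairs (y ∷ xs) ab in there a , there b

∈-closedPairs : ∀ {A : Set} (xs : List A) {a b} → (a , b) ∈ closedPairs xs → a ∈ xs × b ∈ xs
∈-closedPairs (x ∷ xs) ab = let a , b = ∈-consecPairs (x ∷ xs ++ [ x ]) ab in back a , back b
  where
  back : ∀ {c} → c ∈ x ∷ xs ++ [ x ] → c ∈ x ∷ xs
  back c∈ with ∈-++⁻ (x ∷ xs) c∈
  ... | inj₁ c∈xs        = c∈xs
  ... | inj₂ (here refl) = here refl

chain-closed : ∀ {A : Set} {R : A × A → Set} {Q : A → Set} → (∀ {a b} → R (a , b) → Q a → Q b) →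
  ∀ x xs → All R (consecPairs (x ∷ xs)) → Q x → ∀ {y} → y ∈ x ∷ xs → Q y
chain-closed step x xs       ps       Qx (here refl) = Qx
chain-closed step x (_ ∷ xs) (p ∷ ps) Qx (there y∈)  = chain-closed step _ xs ps (step p Qx) y∈

-- Two vertices after `a` are named because the predecessor of `a` lies in `second ∷ rest`; `unique`
-- then separates it from `next`, so `a` has two distinct neighbours on the cycle.
record CycleFrom {n} {Γ : SignedGraph n} (C : Cycle Γ) (a : Fin n) : Set where
  field
    next second : Fin n
    rest        : List (Fin n)
    permutation : verts C ↭ a ∷ next ∷ second ∷ rest
    pairs       : All (_∈ closedPairs (verts C)) (closedPairs (a ∷ next ∷ second ∷ rest))
    unique      : Unique (a ∷ next ∷ second ∷ rest)

cycle-from : ∀ {n} {Γ : SignedGraph n} (C : Cycle Γ) {a} → a ∈ verts C → CycleFrom C a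
cycle-from {n} C {a} a∈ with ys , zs , eq ← ∈-∃++ a∈ =
  shape (zs ++ ys) perm (closedPairs-rotate ys (a ∷ zs)
    (subst (λ l → All (_∈ closedPairs (verts C)) (closedPairs l)) eq (All.tabulate (λ e → e))))
  where
  perm : verts C ↭ a ∷ zs ++ ys
  perm = subst (_↭ a ∷ zs ++ ys) (sym eq) (++-comm ys (a ∷ zs))
  shape : ∀ r → verts C ↭ a ∷ r → All (_∈ closedPairs (verts C)) (closedPairs (a ∷ r)) → CycleFrom C a
  shape []          p ps = contradiction (subst (3 ≤_) (↭-length p) (long C)) λ { (s≤s ()) }
  shape (_ ∷ [])    p ps = contradiction (subst (3 ≤_) (↭-length p) (long C)) λ { (s≤s (s≤s ())) }
  shape (u ∷ v ∷ r) p ps = record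
    { next = u ; second = v ; rest = r ; permutation = p ; pairs = ps
    ; unique = Unique-resp-↭ (setoid (Fin n)) (↭⇒↭ₛ p) (distinct C) }

closedPair-adjacent : ∀ {n} {Γ : SignedGraph n} (C : Cycle Γ) {a b} →
  (a , b) ∈ closedPairs (verts C) → adj Γ a b ≡ true
closedPair-adjacent C = All.lookup (edges C)

cycleEdge-swap : ∀ {n} {Γ : SignedGraph n} (C : Cycle Γ) {a b} → CycleEdge C a b → CycleEdge C b a
cycleEdge-swap C (inj₁ e) = inj₂ e
cycleEdge-swap C (inj₂ e) = inj₁ e

cycleEdge-vertex : ∀ {n} {Γ : SignedGraph n} (C : Cycle Γ) {a b} → CycleEdge C a b → b ∈ verts C
cycleEdge-vertex C (inj₁ e) = proj₂ (∈-closedPairs (verts C) e)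
cycleEdge-vertex C (inj₂ e) = proj₁ (∈-closedPairs (verts C) e)

three≤countF : ∀ {n} (P : Fin n → Bool) {a b c} → a ≢ b → a ≢ c → b ≢ c →
  P a ≡ true → P b ≡ true → P c ≡ true → 3 ≤ countF P
three≤countF P {a} {b} {c} a≢b a≢c b≢c Pa Pb Pc =
  subst (3 ≤_) (sym (countF-∖ P a Pa)) (s≤s
    (subst (2 ≤_) (sym (countF-∖ (P ∖ a) b (∖-other P a≢b Pb))) (s≤s
      (subst (1 ≤_) (sym (countF-∖ (P ∖ a ∖ b) c (∖-other (P ∖ a) b≢c (∖-other P a≢c Pc)))) (s≤s z≤n)))))

-- Successor and predecessor on `C` are already two distinct neighbours of `a`; any other neighbour
-- would be a third.
edge-on-cycle : ∀ {n} {Γ : SignedGraph n} (C : Cycle Γ) {a b} → a ∈ verts C → degree Γ a ≤ 2 →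
  adj Γ a b ≡ true → CycleEdge C a b
edge-on-cycle {Γ = Γ} C {a} {b} a∈ deg ab
  with record { next = u ; second = v ; rest = r ; pairs = au ∷ uv ∷ ps ; unique = _ ∷ (u∉ ∷ _) } ← cycle-from C a∈
  with u′ , u′∈ , u′a ← last-pair v r a ps
  with b ≟ u | b ≟ u′
... | yes refl | _        = inj₁ au
... | no  _    | yes refl = inj₂ u′a
... | no  b≢u  | no  b≢u′ = contradiction (ℕₚ.≤-trans
        (three≤countF (adj Γ a) b≢u b≢u′ (All.lookup u∉ u′∈) ab (closedPair-adjacent C au)
          (trans (adj-sym Γ a u′) (closedPair-adjacent C u′a))) deg) λ { (s≤s (s≤s ())) }

module _ {n} {Γ : SignedGraph n} (C D : Cycle Γ) (low : ∀ {a} → a ∈ verts C → degree Γ a ≤ 2)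
  {v} (v∈C : v ∈ verts C) (v∈D : v ∈ verts D) where

  -- A walk along `D` from `v` cannot leave `C`: at each vertex of `C` the low degree makes the next
  -- edge an edge of `C`.
  vertices-⊆ : ∀ {a} → a ∈ verts D → a ∈ verts C
  vertices-⊆ a∈ with record { permutation = perm ; pairs = ps } ← cycle-from D v∈D =
    chain-closed {R = _∈ closedPairs (verts D)} {Q = _∈ verts C}
      (λ e a∈C → cycleEdge-vertex C (edge-on-cycle C a∈C (low a∈C) (closedPair-adjacent D e)))
      _ _ ps v∈C (∈-++⁺ˡ (∈-resp-↭ perm a∈))

  edges-⊆ : ∀ {a b} → CycleEdge D a b → CycleEdge C a b
  edges-⊆ (inj₁ e) = let a∈ = vertices-⊆ (proj₁ (∈-closedPairs (verts D) e))
                     in edge-on-cycle C a∈ (low a∈) (closedPair-adjacent D e)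
  edges-⊆ (inj₂ e) = let b∈ = vertices-⊆ (proj₁ (∈-closedPairs (verts D) e))
                     in cycleEdge-swap C (edge-on-cycle C b∈ (low b∈) (closedPair-adjacent D e))

branching-vertex : ∀ {n} {Γ : SignedGraph n} → CyclesShareVertex Γ →
  Σ (Cycle Γ) λ C → ∃ λ w → w ∈ verts C × 3 ≤ degree Γ w
branching-vertex {Γ = Γ} (C , D , v , different , v∈C , v∈D)
  with All.all? (λ a → degree Γ a ℕ.≤? 2) (verts C)
... | no  ¬low = let w , w∈ , w≰2 = find (¬All⇒Any¬ (λ a → degree Γ a ℕ.≤? 2) (verts C) ¬low)
                 in C , w , w∈ , ℕₚ.≰⇒> w≰2
... | yes all-low = contradiction same different
  where
  low : ∀ {a} → a ∈ verts C → degree Γ a ≤ 2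
  low = All.lookup all-low
  same : SameCycle C D
  -- The degree bound, known on `C`, passes to `D` through `vertices-⊆`, so the argument also runs
  -- with the two cycles exchanged.
  same _ _ = edges-⊆ D C (λ a∈ → low (vertices-⊆ C D low v∈C v∈D a∈)) v∈D v∈C
           , edges-⊆ C D low v∈C v∈D

-- Starting from an edge of C and never processing w, the search reaches both
-- neighbours of w on C, so processing w afterwards saves one seed.
search-from-cycle : ∀ {n} {Γ : SignedGraph n} (C : Cycle Γ) {w} → w ∈ verts C → 3 ≤ degree Γ w →
  Σ (Search Γ 1) λ s → visited s w ≡ true
search-from-cycle {n} {Γ} C {w} w∈ deg≥3
  with record { next = u ; second = v ; rest = r ; pairs = wu ∷ uv ∷ ps ; unique = (w≢u ∷ w∉) ∷ (u∉ ∷ _) } ← cycle-from C w∈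
  with u′ , u′∈ , u′w ← last-pair v r w ps
  = proj₁ step , proj₁ (proj₂ step) w w-visited
  where
  U : Fin n → Bool
  U i = not ⌊ w ≟ i ⌋
  U-other : ∀ {i} → w ≢ i → U i ≡ true
  U-other {i} w≢i with w ≟ i
  ... | yes w≡i = contradiction w≡i w≢i
  ... | no  _   = refl
  -- The edge from `u` to `v` avoids `w`, so the rest of `C` can be walked from `v` up to `u′`
  -- through processed vertices.
  started = start (empty Γ) u v (closedPair-adjacent C uv)
  closed-up = close U _ (proj₁ started) ℕₚ.≤-refl
  s = proj₁ closed-up
  initial : ∀ i → visited (proj₁ started) i ≡ true → visited s i ≡ true
  initial = proj₁ (proj₂ closed-up)
  spread : ∀ {i j} → w ≢ i → visited s i ≡ true → adj Γ i j ≡ true → visited s j ≡ true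
  spread {i} {j} w≢i vᵢ ij = saturated s i j (proj₁ (proj₂ (proj₂ closed-up)) i vᵢ (U-other w≢i)) ij
  u-visited : visited s u ≡ true
  u-visited = initial u (proj₁ (proj₂ (proj₂ started)))
  v-visited : visited s v ≡ true
  v-visited = initial v (proj₁ (proj₂ (proj₂ (proj₂ started))))
  w-adj-u : adj Γ w u ≡ true
  w-adj-u = closedPair-adjacent C wu
  w-visited : visited s w ≡ true
  w-visited = spread w≢u u-visited (trans (adj-sym Γ u w) w-adj-u)
  walk : ∀ x xs → All (_∈ closedPairs (verts C)) (consecPairs ((x ∷ xs) ++ [ w ])) → All (w ≢_) (x ∷ xs) →
    visited s x ≡ true → ∀ {y} → y ∈ x ∷ xs → visited s y ≡ true
  walk x xs       ps       w≢         vx (here refl) = vx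
  walk x (_ ∷ xs) (p ∷ ps) (w≢x ∷ w≢) vx (there y∈)  =
    walk _ xs ps w≢ (spread w≢x vx (closedPair-adjacent C p)) y∈
  u′-visited : visited s u′ ≡ true
  u′-visited = walk v r ps w∉ v-visited u′∈
  w-unprocessed : processed s w ≡ false
  w-unprocessed = trans (proj₂ (proj₂ (proj₂ closed-up)) w (cong not (≟-refl w)))
                        (proj₂ (proj₂ (proj₂ (proj₂ started))) w)
  -- Two visited neighbours leave `f` at most `d - 2`, and the last fresh one is forced, so the cost
  -- is below the excess and one of the two starting seeds can be charged to `w`. For `f = 0`
  -- nothing is forced; then `3 ≤ d` makes the excess positive.
  saving : ∀ f d → suc (suc f) ≤ d → 3 ≤ d → 2 ℕ.+ (f ∸ 1) ≤ 1 ℕ.+ (d ∸ 2)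
  saving zero    (suc (suc d)) _              (s≤s 2≤1+d) = 2≤1+d
  saving (suc f) (suc (suc d)) (s≤s (s≤s f<d)) _          = s≤s f<d
  step = process s 1 w w-visited w-unprocessed (saving _ _
    (fresh-two s w (All.lookup u∉ u′∈) w-adj-u u-visited
      (trans (adj-sym Γ w u′) (closedPair-adjacent C u′w)) u′-visited) deg≥3)

theorem3p1 : ∀ {n} (Γ : SignedGraph n) → ComponentsNontrivial Γ →
    (1 ≤ pendants Γ → + η Γ ℤ.≤ (+ 2 ℤ.* cyclomatic Γ ℤ.+ + pendants Γ) ℤ.- + 1)
    × (pendants Γ ≡ 0 → CycleDisjoint Γ → + η Γ ℤ.≤ + 2 ℤ.* cyclomatic Γ)
    × (pendants Γ ≡ 0 → CyclesShareVertex Γ → + η Γ ℤ.≤ + 2 ℤ.* cyclomatic Γ ℤ.- + 1)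
theorem3p1 {n} Γ nontrivial = some-pendant , (λ p≡0 _ → no-pendant p≡0) , shared-vertex
  where
  B = 2 ℕ.* ω Γ ℕ.+ sumF (excess Γ)

  bound-1 : η Γ ℕ.+ 1 ≤ B → + η Γ ℤ.≤ + B ℤ.- + 1
  bound-1 le = ℤₚ.≤-trans (ℤₚ.≤-reflexive (add-sub (+ η Γ))) (ℤₚ.+-monoˡ-≤ (- (+ 1)) (ℤ.+≤+ le))
    where
    add-sub : ∀ x → x ≡ x + + 1 + - (+ 1)
    add-sub = solve-∀

  without-pendants : pendants Γ ≡ 0 → + 2 * cyclomatic Γ ≡ + B
  without-pendants p≡0 = trans (sym (+-identityʳ (+ 2 * cyclomatic Γ)))
    (trans (cong (λ p → + 2 * cyclomatic Γ + + p) (sym p≡0)) (cyclomatic-excess Γ nontrivial))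

  some-pendant : 1 ≤ pendants Γ → + η Γ ℤ.≤ (+ 2 ℤ.* cyclomatic Γ ℤ.+ + pendants Γ) ℤ.- + 1
  some-pendant p≥1 =
    let z , pendant = countF-positive (λ i → degree Γ i ≡ᵇ 1) p≥1
        y , zy = has-neighbour nontrivial z
        s , vz = start-pendant z y zy (ℕₚ.≡ᵇ⇒≡ (degree Γ z) 1 (subst IsTrue (sym pendant) _))
    in subst (λ x → + η Γ ℤ.≤ x ℤ.- + 1) (sym (cyclomatic-excess Γ nontrivial))
         (bound-1 (search-bound-saving nontrivial s z vz))

  no-pendant : pendants Γ ≡ 0 → + η Γ ℤ.≤ + 2 ℤ.* cyclomatic Γ
  no-pendant p≡0 = subst (+ η Γ ℤ.≤_) (sym (without-pendants p≡0)) (ℤ.+≤+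
    (subst (_≤ B) (ℕₚ.+-identityʳ (η Γ)) (search-bound nontrivial 0 (empty Γ) (λ _ ()) z≤n)))

  shared-vertex : pendants Γ ≡ 0 → CyclesShareVertex Γ → + η Γ ℤ.≤ + 2 ℤ.* cyclomatic Γ ℤ.- + 1
  shared-vertex p≡0 share =
    let C , w , w∈ , deg≥3 = branching-vertex share
        s , vw = search-from-cycle C w∈ deg≥3
    in subst (λ x → + η Γ ℤ.≤ x ℤ.- + 1) (sym (without-pendants p≡0))
         (bound-1 (search-bound-saving nontrivial s w vw))
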